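{- Consider the 2-stage problem 2-LA-SMP (and its special case 2-L-SMP where $W_1=W_2$). The following online algorithm runs in polynomial time and always outputs an optimal solution: (1) at stage 1, knowing only $U_1$, $W_1$ and the preferences between them, compute the men-optimal stable matching $M_1^*$ of $(U_1,W_1)$; (2) at stage 2, compute a maximum-weight stable matching $M_2^*$ of $(U_2,W_2)$ where pair $(u,w)$ has weight $1$ if $(u,w)\in M_1^*$ and $0$ otherwise. That is, $M_1^*$ is stable for $(U_1,W_1)$, $M_2^*$ is stable for $(U_2,W_2)$, and $|M_1^*\setminus M_2^*|\le|M_1\setminus M_2|$ for every pair $(M_1,M_2)$ with $M_1$ stable for $(U_1,W_1)$ and $M_2$ stable for $(U_2,W_2)$.
   Context: 2-LA-SMP: given finite sets of men $U_2\subseteq U_1$ and of women $W_1\subseteq W_2$, each man in $U_1$ having a strict total order over $W_2$ and each woman in $W_2$ a strict total order over $U_1$, compute $(M_1,M_2)$ with $M_1$ stable for $(U_1,W_1)$ and $M_2$ stable for $(U_2,W_2)$ (preferences restricted accordingly), minimizing $|M_1\setminus M_2|$. A matching is a set of man–woman pairs with each person in at most one pair; a blocking pair of $M$ is a pair $(u,w)\notin M$ with ($u$ unmatched or preferring $w$ to his partner) and ($w$ unmatched or preferring $u$ to her partner); stable means no blocking pair. The men-optimal stable matching gives every man his most preferred partner among those he has in some stable matching. A maximum-weight stable matching is a stable matching of maximum total weight. -}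

module Defs where

open import Data.Bool using (if_then_else_; _∧_)
open import Data.Fin using (Fin; toℕ; fromℕ<)
open import Data.Fin.Subset using (Subset; _∈_; ∣_∣; _─_; ⊤)
open import Data.Fin.Subset.Properties using (_∈?_)
open import Data.List using (List; []; _∷_; map; filter; length; allFin)
open import Data.Nat using (ℕ; zero; suc; _+_; _*_; _∸_; _^_; _≤_; _<?_; _≡ᵇ_)
open import Data.Nat.Properties using (+-0-commutativeMonoid)
open import Algebra.Properties.CommutativeMonoid.Sum +-0-commutativeMonoid using (sum)
open import Data.Product using (∃-syntax; _×_)
open import Data.Sum using (_⊎_)
open import Data.Vec using (Vec; lookup; zipWith)
open import Function using (_⇔_)
open import Level using (0ℓ)
open import Relation.Binary using (Rel; IsStrictTotalOrder)
open import Relation.Binary.PropositionalEquality using (_≡_; _≢_)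
open import Relation.Nullary using (¬_; does; yes; no)

------------------------------------------------------------------------
-- Stable matchings
--
-- In a two-stage instance U₁ = Fin n and W₂ = Fin m (as subsets: ⊤), while
-- U₂ : Subset n and W₁ : Subset m are arbitrary.

record Preferences (n m : ℕ) : Set₁ where
  field
    -- ManPrefers u w w′ : u prefers w to w′
    ManPrefers   : Fin n → Rel (Fin m) 0ℓ
    WomanPrefers : Fin m → Rel (Fin n) 0ℓ
    manOrder     : ∀ u → IsStrictTotalOrder _≡_ (ManPrefers u)
    womanOrder   : ∀ w → IsStrictTotalOrder _≡_ (WomanPrefers w)

-- A set of man–woman pairs: row u is the set of women paired with u.
PairSet : ℕ → ℕ → Set
PairSet n m = Vec (Subset m) n

infix 4 ⟨_,_⟩∈_

⟨_,_⟩∈_ : ∀ {n m} → Fin n → Fin m → PairSet n m → Set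
⟨ u , w ⟩∈ M = w ∈ lookup M u

infixl 5 _∖_

_∖_ : ∀ {n m} → PairSet n m → PairSet n m → PairSet n m
_∖_ = zipWith _─_

size : ∀ {n m} → PairSet n m → ℕ
size M = sum λ u → ∣ lookup M u ∣

totalWeight : ∀ {n m} → (Fin n → Fin m → ℕ) → PairSet n m → ℕ
totalWeight ω M =
  sum λ u → sum λ w → if does (w ∈? lookup M u) then ω u w else 0

indicator : ∀ {n m} → PairSet n m → Fin n → Fin m → ℕ
indicator M u w = if does (w ∈? lookup M u) then 1 else 0

record IsMatching {n m : ℕ} (U : Subset n) (W : Subset m)
                  (M : PairSet n m) : Set where
  field
    within      : ∀ {u w} → ⟨ u , w ⟩∈ M → u ∈ U × w ∈ W
    uniqueWoman : ∀ {u w w′} → ⟨ u , w ⟩∈ M → ⟨ u , w′ ⟩∈ M → w ≡ w′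
    uniqueMan   : ∀ {u u′ w} → ⟨ u , w ⟩∈ M → ⟨ u′ , w ⟩∈ M → u ≡ u′

module _ {n m : ℕ} (P : Preferences n m) where
  open Preferences P

  record IsBlockingPair (U : Subset n) (W : Subset m) (M : PairSet n m)
                        (u : Fin n) (w : Fin m) : Set where
    field
      man∈      : u ∈ U
      woman∈    : w ∈ W
      notPaired : ¬ ⟨ u , w ⟩∈ M
      manWants  : ¬ (∃[ w′ ] ⟨ u , w′ ⟩∈ M)
                ⊎ (∃[ w′ ] (⟨ u , w′ ⟩∈ M × ManPrefers u w w′))
      womanWants : ¬ (∃[ u′ ] ⟨ u′ , w ⟩∈ M)
                 ⊎ (∃[ u′ ] (⟨ u′ , w ⟩∈ M × WomanPrefers w u u′))

  record IsStable (U : Subset n) (W : Subset m) (M : PairSet n m) : Set where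
    field
      isMatching : IsMatching U W M
      noBlocking : ∀ u w → ¬ IsBlockingPair U W M u w

  StablePartner : Subset n → Subset m → Fin n → Fin m → Set
  StablePartner U W u w = ∃[ M ] (IsStable U W M × ⟨ u , w ⟩∈ M)

  record IsMenOptimal (U : Subset n) (W : Subset m) (M : PairSet n m) : Set where
    field
      isStable : IsStable U W M
      best     : ∀ u w′ → StablePartner U W u w′ →
                 ∃[ w ] (⟨ u , w ⟩∈ M × (w ≡ w′ ⊎ ManPrefers u w w′))

  record IsMaxWeightStable (U : Subset n) (W : Subset m)
                           (ω : Fin n → Fin m → ℕ) (M : PairSet n m) : Set where
    field
      isStable : IsStable U W M
      maximal  : ∀ M′ → IsStable U W M′ → totalWeight ω M′ ≤ totalWeight ω M

------------------------------------------------------------------------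
-- Machine model: structured programs for a random access machine whose
-- memory consists of two-dimensional arrays of naturals, with unit cost.
-- Arithmetic is limited to addition and truncated subtraction: with unit-cost
-- multiplication, repeated squaring would make "polynomial time" too generous.

Store : Set
Store = ℕ → ℕ → ℕ → ℕ

infixl 6 _⊕_ _⊖_

data Expr : Set where
  lit     : ℕ → Expr
  cell    : ℕ → Expr → Expr → Expr
  _⊕_ _⊖_ : Expr → Expr → Expr

eval : Store → Expr → ℕ
eval s (lit k)      = k
eval s (cell a i j) = s a (eval s i) (eval s j)
eval s (e ⊕ f)      = eval s e + eval s f
eval s (e ⊖ f)      = eval s e ∸ eval s f

update : Store → ℕ → ℕ → ℕ → ℕ → Store
update s a i j v b k l =
  if (a ≡ᵇ b) ∧ (i ≡ᵇ k) ∧ (j ≡ᵇ l) then v else s b k l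

infixr 4 _⨾_

data Program : Set where
  skip   : Program
  assign : (a : ℕ) (i j : Expr) (e : Expr) → Program
  _⨾_    : Program → Program → Program
  ifElse : Expr → Program → Program → Program
  while  : Expr → Program → Program

-- Run c s s′ t : started in s, c halts in s′ after t steps.  A step is an
-- assignment, a skip or a test (an expression counts as true when nonzero);
-- the expressions of a fixed program have bounded size.
data Run : Program → Store → Store → ℕ → Set where
  run-skip   : ∀ {s} → Run skip s s 1
  run-assign : ∀ {a i j e s} →
               Run (assign a i j e) s (update s a (eval s i) (eval s j) (eval s e)) 1
  run-seq    : ∀ {c d s s′ s″ t t′} →
               Run c s s′ t → Run d s′ s″ t′ → Run (c ⨾ d) s s″ (t + t′)
  run-then   : ∀ {e c d s s′ t} → eval s e ≢ 0 →
               Run c s s′ t → Run (ifElse e c d) s s′ (suc t)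
  run-else   : ∀ {e c d s s′ t} → eval s e ≡ 0 →
               Run d s s′ t → Run (ifElse e c d) s s′ (suc t)
  run-stop   : ∀ {e c s} → eval s e ≡ 0 → Run (while e c) s s 1
  run-loop   : ∀ {e c s s′ s″ t t′} → eval s e ≢ 0 →
               Run c s s′ t → Run (while e c) s′ s″ t′ →
               Run (while e c) s s″ (suc (t + t′))

------------------------------------------------------------------------
-- Encoding of inputs and outputs

members : ∀ {n} → Subset n → List (Fin n)
members U = filter (_∈? U) (allFin _)

at : List ℕ → ℕ → ℕ
at []       _       = 0
at (x ∷ _)  zero    = x
at (_ ∷ xs) (suc i) = at xs i

-- The table of f on U × W, 0 elsewhere.
table : ∀ {n m} → Subset n → Subset m → (Fin n → Fin m → ℕ) → ℕ → ℕ → ℕ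
table {n} {m} U W f i j with i <? n | j <? m
... | no  _ | _     = 0
... | yes _ | no  _ = 0
... | yes p | yes q with fromℕ< p ∈? U | fromℕ< q ∈? W
...   | yes _ | yes _ = f (fromℕ< p) (fromℕ< q)
...   | yes _ | no  _ = 0
...   | no  _ | _     = 0

module _ {n m : ℕ} (P : Preferences n m) where
  open Preferences P

  -- The position of w in the preference list of u restricted to W, and the
  -- same for women: 0 is the favourite.
  manRank : Subset m → Fin n → Fin m → ℕ
  manRank W u w = length
    (filter (λ w′ → IsStrictTotalOrder._<?_ (manOrder u) w′ w) (members W))

  womanRank : Subset n → Fin n → Fin m → ℕ
  womanRank U u w = length
    (filter (λ u′ → IsStrictTotalOrder._<?_ (womanOrder w) u′ u) (members U))

  -- The initial memory for the market (U , W) with pair weights ω.  It depends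
  -- only on U, W and the preferences and weights between them: persons outside
  -- U and W leave no trace, and n and m themselves are not part of the input.
  inputStore : Subset n → Subset m → (Fin n → Fin m → ℕ) → Store
  inputStore U W ω 0 i j = at (length (members U) ∷ length (members W) ∷ []) i
  inputStore U W ω 1 i j = at (map toℕ (members U)) i
  inputStore U W ω 2 i j = at (map toℕ (members W)) i
  inputStore U W ω 3 i j = table U W (manRank W) i j
  inputStore U W ω 4 i j = table U W (womanRank U) i j
  inputStore U W ω 5 i j = table U W ω i j
  inputStore U W ω _ i j = 0

-- The output is the set of pairs marked with 1 in array 6.
Outputs : ∀ {n m} → Store → PairSet n m → Set
Outputs s M = ∀ u w → ⟨ u , w ⟩∈ M ⇔ s 6 (toℕ u) (toℕ w) ≡ 1

ComputesWithin : ∀ {n m} → Program → Store → ℕ → PairSet n m → Set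
ComputesWithin c s T M =
  ∃[ s′ ] ∃[ t ] (Run c s s′ t × t ≤ T × Outputs s′ M)

-- Every polynomial in the numbers of men and women is bounded by some
-- k * (1 + ∣ U ∣ + ∣ W ∣) ^ d.
polyBound : ∀ {n m} → ℕ → ℕ → Subset n → Subset m → ℕ
polyBound k d U W = k * (1 + ∣ U ∣ + ∣ W ∣) ^ d

-- c₁ and c₂ implement the two stages of the online algorithm within the time
-- bound given by k and d.  The first stage receives no weights (all are 0).
Implements : Program → Program → ℕ → ℕ → Set₁
Implements c₁ c₂ k d =
  ∀ {n m} (P : Preferences n m) (W₁ : Subset m) →
  ∃[ M₁* ]
    ( ComputesWithin c₁ (inputStore P ⊤ W₁ (λ _ _ → 0)) (polyBound k d (⊤ {n}) W₁) M₁*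
    × IsMenOptimal P ⊤ W₁ M₁*
    × (∀ (U₂ : Subset n) →
       ∃[ M₂* ]
         ( ComputesWithin c₂ (inputStore P U₂ ⊤ (indicator M₁*)) (polyBound k d U₂ (⊤ {m})) M₂*
         × IsMaxWeightStable P U₂ ⊤ (indicator M₁*) M₂* )))

{-# OPTIONS --safe #-}
module Submission where

-- Let M₁ be stable for (U₁ , W₁) and M₂ for (U₂ , W₂), with U₂ ⊆ U₁ and W₁ ⊆ W₂.  The women
-- whom the men gaining from M₁ get there are, in M₂, partners of men who gain as well; by
-- finiteness this is a bijection, so that giving every man of U₂ the better of his two partners
-- yields a matching M₂ ∨ M₁ stable for (U₂ , W₂).  If M₁* is men-optimal, then M₂ ∨ M₁* contains
-- the M₁*-pair of every man with the same partner in M₁ and M₂; as M₁ and M₁* match the same men,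
-- optimality follows.
--
-- Since M₂ ∨ M₁* keeps the pairs common to M₂ and M₁*, a maximum-weight M₂ can be sought among
-- the stable matchings in which no man is worse off than in M₁*.  The men-pessimal one of these
-- contains every pair of M₁* that some stable matching contains.  It is found by deferred
-- acceptance with the women proposing and the men refusing everyone worse than their partner in
-- M₁*, so both stages are variants of the Gale–Shapley algorithm.
open import Defs
open import Data.Bool using (Bool; true; false; not; T; _∧_; _∨_; if_then_else_)
open import Data.Bool.Properties using (∨-conicalˡ; ∨-conicalʳ)
open import Data.Empty using (⊥; ⊥-elim)
open import Data.Fin using (Fin; zero; suc; toℕ; fromℕ<; punchOut) renaming (_≟_ to _≟ᶠ_)
open import Data.Fin.Induction using (spo-wellFounded)
open import Data.Fin.Properties using (any?; all?; injective⇒≤; punchOut-injective; fromℕ<-toℕ; toℕ<n; toℕ-injective)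
open import Data.Fin.Subset using (Subset; inside; outside; _∈_; _⊆_; _─_; ∣_∣; ⊤; Nonempty)
open import Data.Fin.Subset.Properties using (_∈?_; drop-there; ∈⊤; ⊆⊤; p─q⊆p; x∈p∧x∉q⇒x∈p─q; nonempty?; p⊆q⇒∣p∣≤∣q∣; ∣⁅x⁆∣≡1; x∈⁅x⁆; x∈⁅y⁆⇒x≡y)
open import Data.List using (List; []; _∷_; map; filter; length; allFin; cartesianProduct) renaming (tabulate to tabulateˡ)
open import Data.List.Properties using (length-map; length-++; filter-notAll)
open import Data.List.Membership.Propositional using (lose) renaming (_∈_ to _∈ˡ_)
open import Data.List.Membership.Propositional.Properties using (∈-filter⁺; ∈-filter⁻; ∈-allFin; ∈-cartesianProduct⁺)
open import Data.List.Relation.Unary.Any using (here; there)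
open import Data.Nat using (ℕ; zero; suc; _+_; _*_; _∸_; _^_; _≤_; _<_; _≟_; _<?_; _≡ᵇ_; z≤n; s≤s; NonZero; >-nonZero⁻¹)
open import Data.Nat.Properties using (+-0-commutativeMonoid; +-suc; +-identityʳ; +-mono-≤; +-monoʳ-≤; +-monoˡ-≤; +-cancelʳ-≤; *-distribʳ-+; *-mono-≤; *-monoʳ-≤; *-monoˡ-≤; ^-monoʳ-≤; m^n>0; 0∸n≡0; m>n⇒m∸n≢0; m∸n≢0⇒n<m; 1+n≰n; <-asym; <-irrefl; <⇒≱; m≤m+n; m≤n+m; m≤n⇒m<n∨m≡n; m≤n⇒m≤1+n; n≤1+n; ≡ᵇ⇒≡; ≤-refl; ≤-reflexive; ≤-trans; module ≤-Reasoning)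
open import Data.Nat.Solver using (module +-*-Solver)
open import Algebra.Properties.CommutativeMonoid.Sum +-0-commutativeMonoid using (sum; sum-cong-≗; ∑-distrib-+)
open import Data.Product using (∃-syntax; _×_; _,_; proj₁; proj₂)
open import Data.Sum using (_⊎_; inj₁; inj₂; [_,_])
open import Data.Unit using (tt) renaming (⊤ to Unit)
open import Data.Vec using ([]; _∷_; here; there; lookup; tabulate)
open import Data.Vec.Properties using (lookup∘tabulate; lookup⇒[]=; []=⇒lookup; lookup-zipWith)
open import Function using (flip; _∘_; id; _⇔_; mk⇔; Equivalence)
open import Function.Definitions using (Injective)
open import Induction.WellFounded using (Acc; acc)
open import Level using (0ℓ)
open import Relation.Binary using (Rel; IsStrictTotalOrder; tri<; tri≈; tri>)
open import Relation.Binary.PropositionalEquality using (_≡_; _≢_; refl; sym; trans; cong; cong₂; subst; subst₂)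
open import Relation.Nullary using (¬_; Dec; yes; no; does; contradiction; ¬?; _×-dec_; _⊎-dec_; _→-dec_)
open import Relation.Nullary.Decidable using (dec-true; decidable-stable)
open import Relation.Unary using (Pred; Decidable)

-- Finite sets

-- For arbitrary weights, a maximum-weight stable matching is usually found by linear programming or
-- by a minimum cut, which would be laborious on a machine that only adds and subtracts. The weights
-- at hand avoid this because all attainable pairs of `M₁*` can be kept at once: a man's refusals
-- hold him at such a pair from below, men-pessimality holds him there from above. The price is that
-- refusals may leave a man single and so create blocking pairs; excluding this is the second use of
-- the join. On the program side the obstacle is reasoning about nested loops that overwrite arrays.
-- The usual queue of free proposers is therefore replaced by simultaneous rounds whose only state
-- is the set of rejected pairs. Each round consists of sweeps, none of which reads the array it
-- fills, so that the effect of a sweep can be read off from the store before it.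

injective⇒hits : ∀ {n} (f : Fin n → Fin n) → Injective _≡_ _≡_ f → ∀ y → ∃[ x ] f x ≡ y
injective⇒hits {suc n} f inj y with any? (λ x → f x ≟ᶠ y)
... | yes hit  = hit
... | no  miss = ⊥-elim (1+n≰n (injective⇒≤ {f = λ x → punchOut (y≢f x)}
                   λ {x} {x′} eq → inj (punchOut-injective (y≢f x) (y≢f x′) eq)))
  where
  y≢f : ∀ x → y ≢ f x
  y≢f x eq = miss (x , sym eq)

-- The relation restricts to an injective map of A, extended by the identity outside A.
injective-on⇒hits : ∀ {n} {A : Pred (Fin n) 0ℓ} {T : Rel (Fin n) 0ℓ} → Decidable A →
                    (∀ {x} → A x → ∃[ y ] (A y × T x y)) →
                    (∀ {x x′ y} → T x y → T x′ y → x ≡ x′) →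
                    ∀ {y} → A y → ∃[ x ] (A x × T x y)
injective-on⇒hits {n} {A} {T} A? image T-inj {y} Ay = result
  where
  f : Fin n → Fin n
  f x with A? x
  ... | yes Ax = proj₁ (image Ax)
  ... | no  _  = x

  f-spec : ∀ x → (A x × A (f x) × T x (f x)) ⊎ (¬ A x × f x ≡ x)
  f-spec x with A? x
  ... | yes Ax = inj₁ (Ax , proj₂ (image Ax))
  ... | no ¬Ax = inj₂ (¬Ax , refl)

  f-inj : Injective _≡_ _≡_ f
  f-inj {x} {x′} eq with f-spec x | f-spec x′
  ... | inj₁ (_ , _ , t)   | inj₁ (_ , _ , t′)   = T-inj t (subst (T x′) (sym eq) t′)
  ... | inj₁ (_ , Afx , _) | inj₂ (¬Ax′ , fx′)   = contradiction (subst A (trans eq fx′) Afx) ¬Ax′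
  ... | inj₂ (¬Ax , fx)    | inj₁ (_ , Afx′ , _) = contradiction (subst A (trans (sym eq) fx) Afx′) ¬Ax
  ... | inj₂ (_ , fx)      | inj₂ (_ , fx′)      = trans (sym fx) (trans eq fx′)

  result : ∃[ x ] (A x × T x y)
  result with injective⇒hits f f-inj y
  ... | x , fx≡y with f-spec x
  ...   | inj₁ (Ax , _ , t) = x , Ax , subst (T x) fx≡y t
  ...   | inj₂ (¬Ax , fx)   = contradiction (subst A (trans (sym fx≡y) fx) Ay) ¬Ax

module _ {n} {_≻_ : Rel (Fin n) 0ℓ} (≻-order : IsStrictTotalOrder _≡_ _≻_) where
  private module O = IsStrictTotalOrder ≻-order

  -- x ≻ y means that x is preferred, so "best" is minimal for the order.
  best-satisfying : {Q : Pred (Fin n) 0ℓ} → Decidable Q → ∀ {y} → Q y →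
                    ∃[ x ] (Q x × (x ≡ y ⊎ x ≻ y) × (∀ z → z ≻ x → ¬ Q z))
  best-satisfying {Q} Q? {y} Qy = go Qy (spo-wellFounded O.isStrictPartialOrder y)
    where
    go : ∀ {y} → Q y → Acc _≻_ y →
         ∃[ x ] (Q x × (x ≡ y ⊎ x ≻ y) × (∀ z → z ≻ x → ¬ Q z))
    go {y} Qy (acc rec) with any? (λ z → (z O.<? y) ×-dec Q? z)
    ... | no none = y , Qy , inj₁ refl , λ z z≻y Qz → none (z , z≻y , Qz)
    ... | yes (z , z≻y , Qz) with go Qz (rec z≻y)
    ...   | x , Qx , inj₁ refl , top = x , Qx , inj₂ z≻y , top
    ...   | x , Qx , inj₂ x≻z , top = x , Qx , inj₂ (O.trans x≻z z≻y) , top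

-- Stable relations

dual : ∀ {n m} → Preferences n m → Preferences m n
dual P = record
  { ManPrefers = WomanPrefers ; WomanPrefers = ManPrefers
  ; manOrder = womanOrder ; womanOrder = manOrder }
  where open Preferences P

PairRel : ℕ → ℕ → Set₁
PairRel n m = Fin n → Fin m → Set

-- A positive form of stability, invariant under exchanging the two sides.
record Stable {n m} (P : Preferences n m) (U : Subset n) (W : Subset m)
              (M : PairRel n m) : Set where
  open Preferences P
  field
    decide : ∀ u w → Dec (M u w)
    man∈   : ∀ {u w} → M u w → u ∈ U
    woman∈ : ∀ {u w} → M u w → w ∈ W
    wife!  : ∀ {u w w′} → M u w → M u w′ → w ≡ w′
    man!   : ∀ {u u′ w} → M u w → M u′ w → u ≡ u′
    settled : ∀ {u w} → u ∈ U → w ∈ W →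
              M u w ⊎ (∃[ w′ ] (M u w′ × ManPrefers u w′ w))
                    ⊎ (∃[ u′ ] (M u′ w × WomanPrefers w u′ u))

Stable-dual : ∀ {n m} {P : Preferences n m} {U W M} → Stable P U W M →
              Stable (dual P) W U (flip M)
Stable-dual st = record
  { decide = flip decide ; man∈ = woman∈ ; woman∈ = man∈ ; wife! = man! ; man! = wife!
  ; settled = λ w∈ u∈ → [ inj₁ , [ inj₂ ∘ inj₂ , inj₂ ∘ inj₁ ] ] (settled u∈ w∈) }
  where open Stable st

module _ {n m} (P : Preferences n m) where
  open Preferences P
  private
    module MO u = IsStrictTotalOrder (manOrder u)
    module WO w = IsStrictTotalOrder (womanOrder w)

  AtLeast : Fin n → Rel (Fin m) 0ℓ
  AtLeast u w w′ = w ≡ w′ ⊎ ManPrefers u w w′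

  atLeast? : ∀ u w w′ → Dec (AtLeast u w w′)
  atLeast? u w w′ = MO._≟_ u w w′ ⊎-dec MO._<?_ u w w′

  atLeast-antisym : ∀ {u w w′} → AtLeast u w w′ → AtLeast u w′ w → w ≡ w′
  atLeast-antisym (inj₁ eq) _ = eq
  atLeast-antisym (inj₂ _) (inj₁ eq) = sym eq
  atLeast-antisym {u} (inj₂ p) (inj₂ q) = contradiction q (MO.asym u p)

  not-preferred : ∀ {u w w′} → AtLeast u w w′ → ¬ ManPrefers u w′ w
  not-preferred {u} (inj₁ refl) = MO.irrefl u refl
  not-preferred {u} (inj₂ p)    = MO.asym u p

  not-atLeast : ∀ {u w w′} → ¬ AtLeast u w w′ → ManPrefers u w′ w
  not-atLeast {u} {w} {w′} ¬p with MO.compare u w w′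
  ... | tri< p _ _ = contradiction (inj₂ p) ¬p
  ... | tri≈ _ p _ = contradiction (inj₁ p) ¬p
  ... | tri> _ _ p = p

  -- The join of stable matchings of two nested markets

  module Join {U₁ U₂ : Subset n} {W₁ W₂ : Subset m} (U₂⊆U₁ : U₂ ⊆ U₁) (W₁⊆W₂ : W₁ ⊆ W₂)
              {M₁ M₂ : PairRel n m} (st₁ : Stable P U₁ W₁ M₁) (st₂ : Stable P U₂ W₂ M₂) where
    private
      module S₁ = Stable st₁
      module S₂ = Stable st₂

    -- Vacuous if `u` is single in `M`: being single counts as worse than any partner. `Gains`
    -- follows the same convention.
    AtLeastIn : PairRel n m → Fin n → Fin m → Set
    AtLeastIn M u w = ∀ w′ → M u w′ → AtLeast u w w′

    Gains : Fin n → Set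
    Gains u = u ∈ U₂ × ∃[ w ] (M₁ u w × (∀ w′ → M₂ u w′ → ManPrefers u w w′))

    gains? : Decidable Gains
    gains? u = (u ∈? U₂) ×-dec any? λ w → S₁.decide u w ×-dec
                 all? λ w′ → S₂.decide u w′ →-dec MO._<?_ u w w′

    Displaces : Rel (Fin n) 0ℓ
    Displaces u u′ = ∃[ w ] (M₁ u w × M₂ u′ w)

    -- Since `(u , w)` does not block `M₂`, `w` has an `M₂`-partner `u′` whom she prefers to `u`.
    -- Since `(u′ , w)` does not block `M₁`, `u′` has someone better than `w` there. The first
    -- inference needs `W₁ ⊆ W₂`, the second `U₂ ⊆ U₁`.
    displaced : ∀ {u} → Gains u → ∃[ u′ ] (Gains u′ × Displaces u u′)
    displaced {u} (u∈ , w , m₁ , gain) with S₂.settled u∈ (W₁⊆W₂ (S₁.woman∈ m₁))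
    ... | inj₁ m₂ = contradiction (gain w m₂) (MO.irrefl u refl)
    ... | inj₂ (inj₁ (w′ , m₂ , p)) = contradiction p (MO.asym u (gain w′ m₂))
    ... | inj₂ (inj₂ (u′ , m₂ , p)) with S₁.settled (U₂⊆U₁ (S₂.man∈ m₂)) (S₁.woman∈ m₁)
    ...   | inj₁ m₁′ = contradiction (subst (λ x → WomanPrefers w x u) (S₁.man! m₁′ m₁) p) (WO.irrefl w refl)
    ...   | inj₂ (inj₂ (u″ , m₁″ , q)) =
            contradiction (subst (λ x → WomanPrefers w x u′) (S₁.man! m₁″ m₁) q) (WO.asym w p)
    ...   | inj₂ (inj₁ (w″ , m₁″ , q)) = u′ ,
            (S₂.man∈ m₂ , w″ , m₁″ , λ w‴ m₂′ → subst (ManPrefers u′ w″) (S₂.wife! m₂ m₂′) q) ,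
            w , m₁ , m₂

    displaces-injective : ∀ {u u′ v} → Displaces u v → Displaces u′ v → u ≡ u′
    displaces-injective (w , m₁ , m₂) (w′ , m₁′ , m₂′) with refl ← S₂.wife! m₂ m₂′ = S₁.man! m₁ m₁′

    displacer : ∀ {u} → Gains u → ∃[ u′ ] (Gains u′ × Displaces u′ u)
    displacer = injective-on⇒hits gains? displaced displaces-injective

    -- A man who is single in `M₂` would gain vacuously, but whoever gains has a displacer and hence
    -- an `M₂`-partner. For two matchings of one market this is the rural hospitals theorem for men.
    stays-matched : ∀ {u w} → u ∈ U₂ → M₁ u w → ∃[ w′ ] M₂ u w′
    stays-matched {u} {w} u∈ m₁ with any? (S₂.decide u)
    ... | yes matched = matched
    ... | no  single with displacer (u∈ , w , m₁ , λ w′ m₂ → contradiction (w′ , m₂) single)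
    ...   | _ , _ , w′ , _ , m₂ = w′ , m₂

    join : PairRel n m
    join u w = u ∈ U₂ × ((M₁ u w × AtLeastIn M₂ u w) ⊎ (M₂ u w × AtLeastIn M₁ u w))

    private
      -- If `u` takes `w` from `M₁` without having her in `M₂`, he gains; by `displaced` her
      -- `M₂`-partner `u′` gains as well and gives her up.
      no-mix : ∀ {u u′ w} → u ∈ U₂ → M₁ u w → AtLeastIn M₂ u w → M₂ u′ w → AtLeastIn M₁ u′ w →
               u ≡ u′
      no-mix {u} {u′} {w} u∈ m₁ p m₂ q with S₂.decide u w
      ... | yes m₂′ = S₂.man! m₂′ m₂
      ... | no ¬m₂ with displaced (u∈ , w , m₁ , gain)
        where
        gain : ∀ w′ → M₂ u w′ → ManPrefers u w w′
        gain w′ m₂′ with p w′ m₂′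
        ... | inj₁ refl = contradiction m₂′ ¬m₂
        ... | inj₂ r    = r
      ...   | u″ , (_ , w″ , m₁″ , gain) , w‴ , m₁‴ , m₂″
              with refl ← S₁.wife! m₁ m₁‴
              with refl ← S₂.man! m₂ m₂″ =
              contradiction (gain w m₂) (not-preferred (q w″ m₁″))

    join-partner : ∀ {u} → u ∈ U₂ → (∃[ w ] M₁ u w) ⊎ (∃[ w ] M₂ u w) → ∃[ w ] join u w
    join-partner {u} u∈ e with any? (S₁.decide u) | any? (S₂.decide u)
    ... | no ¬1 | no ¬2 = contradiction e [ ¬1 , ¬2 ]
    ... | yes (w , m) | no ¬2 = w , u∈ , inj₁ (m , λ w′ m′ → contradiction (w′ , m′) ¬2)
    ... | no ¬1 | yes (w , m) = w , u∈ , inj₂ (m , λ w′ m′ → contradiction (w′ , m′) ¬1)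
    ... | yes (w , m) | yes (w′ , m′) with atLeast? u w w′
    ...   | yes p = w , u∈ , inj₁ (m , λ w″ m″ → subst (AtLeast u w) (S₂.wife! m′ m″) p)
    ...   | no ¬p = w′ , u∈ , inj₂ (m′ , λ w″ m″ → subst (AtLeast u w′) (S₁.wife! m m″) (inj₂ (not-atLeast ¬p)))

    join-atLeast₁ : ∀ {u w} → join u w → AtLeastIn M₁ u w
    join-atLeast₁ (_ , inj₁ (m , _)) w′ m′ = inj₁ (S₁.wife! m m′)
    join-atLeast₁ (_ , inj₂ (_ , p)) = p

    join-atLeast₂ : ∀ {u w} → join u w → AtLeastIn M₂ u w
    join-atLeast₂ (_ , inj₁ (_ , p)) = p
    join-atLeast₂ (_ , inj₂ (m , _)) w′ m′ = inj₁ (S₂.wife! m m′)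

    abstract
      join-stable : Stable P U₂ W₂ join
      join-stable = record
        { decide = λ u w → (u ∈? U₂) ×-dec
            ((S₁.decide u w ×-dec all? λ w′ → S₂.decide u w′ →-dec atLeast? u w w′) ⊎-dec
             (S₂.decide u w ×-dec all? λ w′ → S₁.decide u w′ →-dec atLeast? u w w′))
        ; man∈ = proj₁
        ; woman∈ = λ { (_ , inj₁ (m , _)) → W₁⊆W₂ (S₁.woman∈ m) ; (_ , inj₂ (m , _)) → S₂.woman∈ m }
        ; wife! = wife
        ; man! = λ { (_ , inj₁ (m , _)) (_ , inj₁ (m′ , _)) → S₁.man! m m′
                   ; (u∈ , inj₁ (m , p)) (_ , inj₂ (m′ , q)) → no-mix u∈ m p m′ q
                   ; (_ , inj₂ (m , p)) (u∈ , inj₁ (m′ , q)) → sym (no-mix u∈ m′ q m p)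
                   ; (_ , inj₂ (m , _)) (_ , inj₂ (m′ , _)) → S₂.man! m m′ }
        ; settled = λ {u} {w} → settled u w
        }
        where
        wife : ∀ {u w w′} → join u w → join u w′ → w ≡ w′
        wife (_ , inj₁ (m , _)) (_ , inj₁ (m′ , _)) = S₁.wife! m m′
        wife (_ , inj₁ (m , p)) (_ , inj₂ (m′ , q)) = atLeast-antisym (p _ m′) (q _ m)
        wife (_ , inj₂ (m , p)) (_ , inj₁ (m′ , q)) = atLeast-antisym (p _ m′) (q _ m)
        wife (_ , inj₂ (m , _)) (_ , inj₂ (m′ , _)) = S₂.wife! m m′

        Settled : Fin n → Fin m → Set
        Settled u w = join u w ⊎ (∃[ w′ ] (join u w′ × ManPrefers u w′ w))
                               ⊎ (∃[ u′ ] (join u′ w × WomanPrefers w u′ u))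

        -- In `M₂`, `w` has a partner `u′` whom she prefers to `u`. If `u′` leaves her, he gains,
        -- and his displacer `u₀` is her `M₁`-partner, who gains and takes her in the join. As she
        -- is then matched in `M₁`, stability of `M₁` shows that she prefers `u₀` to `u`.
        rejected : ∀ u w → u ∈ U₂ → w ∈ W₂ →
                   (∀ w′ → M₁ u w′ → ManPrefers u w w′) → (∀ w′ → M₂ u w′ → ManPrefers u w w′) →
                   Settled u w
        rejected u w u∈ w∈ p₁ p₂ with S₂.settled u∈ w∈
        ... | inj₁ m₂ = contradiction (p₂ w m₂) (MO.irrefl u refl)
        ... | inj₂ (inj₁ (w′ , m₂ , q)) = contradiction q (MO.asym u (p₂ w′ m₂))
        ... | inj₂ (inj₂ (u′ , m₂ , q)) with all? (λ w′ → S₁.decide u′ w′ →-dec atLeast? u′ w w′)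
        ...   | yes top = inj₂ (inj₂ (u′ , (S₂.man∈ m₂ , inj₂ (m₂ , top)) , q))
        ...   | no ¬top with any? (λ w′ → S₁.decide u′ w′ ×-dec ¬? (atLeast? u′ w w′))
        ...     | no none = contradiction (λ w′ m₁ → decidable-stable (atLeast? u′ w w′)
                              λ ¬p → none (w′ , m₁ , ¬p)) ¬top
        ...     | yes (w′ , m₁ , ¬p) with displacer (S₂.man∈ m₂ , w′ , m₁ ,
                        λ w″ m₂″ → subst (ManPrefers u′ w′) (S₂.wife! m₂ m₂″) (not-atLeast ¬p))
        ...       | u₀ , (u₀∈ , w₀ , m₁⁰ , gain) , w″ , m₁″ , m₂″
                    with refl ← S₂.wife! m₂ m₂″
                    with refl ← S₁.wife! m₁⁰ m₁″
                    with S₁.settled (U₂⊆U₁ u∈) (S₁.woman∈ m₁″)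
        ...         | inj₁ m = contradiction (p₁ _ m) (MO.irrefl u refl)
        ...         | inj₂ (inj₁ (w‴ , m , r)) = contradiction r (MO.asym u (p₁ w‴ m))
        ...         | inj₂ (inj₂ (u‴ , m , r)) with refl ← S₁.man! m m₁″ =
                      inj₂ (inj₂ (u₀ , (u₀∈ , inj₁ (m₁″ , λ w′ m′ → inj₂ (gain w′ m′))) , r))

        settled : ∀ u w → u ∈ U₂ → w ∈ W₂ → Settled u w
        settled u w u∈ w∈ with any? (S₁.decide u) ⊎-dec any? (S₂.decide u)
        ... | no single = rejected u w u∈ w∈ (λ w′ m → contradiction (inj₁ (w′ , m)) single)
                                             (λ w′ m → contradiction (inj₂ (w′ , m)) single)
        ... | yes e with join-partner u∈ e
        ...   | j , J with MO.compare u j w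
        ...     | tri< p _ _ = inj₂ (inj₁ (j , J , p))
        ...     | tri≈ _ refl _ = inj₁ J
        ...     | tri> _ _ p = rejected u w u∈ w∈ (λ w′ m → beats (join-atLeast₁ J w′ m))
                                                  (λ w′ m → beats (join-atLeast₂ J w′ m))
          where
          beats : ∀ {w′} → AtLeast u j w′ → ManPrefers u w w′
          beats (inj₁ refl) = p
          beats (inj₂ q)    = MO.trans u p q

-- Deferred acceptance with the men proposing; R u w says that w has rejected u.

module DeferredAcceptance {n m} (P : Preferences n m) (U : Subset n) (W : Subset m) where
  open Preferences P
  private
    module MO u = IsStrictTotalOrder (manOrder u)
    module WO w = IsStrictTotalOrder (womanOrder w)

  Beatable : PairRel n m → PairRel n m
  Beatable R u w = ∃[ w′ ] (w′ ∈ W × ManPrefers u w′ w × ¬ R u w′)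

  Proposes : PairRel n m → PairRel n m
  Proposes R u w = u ∈ U × w ∈ W × ¬ R u w × ¬ Beatable R u w

  Outbid : PairRel n m → PairRel n m
  Outbid Q u w = ∃[ u′ ] (u′ ∈ U × WomanPrefers w u′ u × Q u′ w)

  -- A woman with a proposer rejects all men she likes less, including those who have not proposed
  -- to her. Proposals are recomputed from `R` and never stored.
  Step : PairRel n m → PairRel n m
  Step R u w = R u w ⊎ (u ∈ U × w ∈ W × Outbid (Proposes R) u w)

  Fixed : PairRel n m → Set
  Fixed R = ∀ {u w} → u ∈ U → w ∈ W → Outbid (Proposes R) u w → R u w

  proposes? : ∀ {R} → (∀ u w → Dec (R u w)) → ∀ u w → Dec (Proposes R u w)
  proposes? R? u w = (u ∈? U) ×-dec (w ∈? W) ×-dec ¬? (R? u w) ×-dec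
    ¬? (any? λ w′ → (w′ ∈? W) ×-dec MO._<?_ u w′ w ×-dec ¬? (R? u w′))

  proposes-cong : ∀ {R R′} → (∀ {u w} → R u w → R′ u w) → (∀ {u w} → R′ u w → R u w) →
                  ∀ {u w} → Proposes R u w → Proposes R′ u w
  proposes-cong to from (u∈ , w∈ , ¬r , top) =
    u∈ , w∈ , ¬r ∘ from , λ (w′ , w′∈ , p , ¬r′) → top (w′ , w′∈ , p , ¬r′ ∘ to)

  -- The number of rounds is fixed in advance, so rounds beyond a fixed point must be harmless:
  -- there `R` and `R′` have the same pairs and thus the same proposals.
  fixed-step : ∀ {R R′} → (∀ u w → R′ u w ⇔ Step R u w) → Fixed R → Fixed R′
  fixed-step {R} {R′} eqv fix u∈ w∈ (u′ , u′∈ , p , pr) =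
    into (fix u∈ w∈ (u′ , u′∈ , p , proposes-cong {R′} {R} back into pr))
    where
    into : ∀ {u w} → R u w → R′ u w
    into r = Equivalence.from (eqv _ _) (inj₁ r)
    back : ∀ {u w} → R′ u w → R u w
    back r = [ (λ r → r) , (λ (u∈ , w∈ , o) → fix u∈ w∈ o) ] (Equivalence.to (eqv _ _) r)

  Avoids : PairRel n m → PairRel n m → Set
  Avoids R M = ∀ {u w} → R u w → ¬ M u w

  -- R₀ is the set of pairs excluded from the outset.
  record Invariant (R₀ R : PairRel n m) : Set₁ where
    field
      rejected? : ∀ u w → Dec (R u w)
      initial   : ∀ {u w} → R₀ u w → R u w
      reason    : ∀ {u w} → R u w → R₀ u w ⊎ Outbid (Proposes R) u w
      unstable  : ∀ {M} → Stable P U W M → Avoids R₀ M → Avoids R M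

  invariant-start : ∀ {R₀ R} → (∀ u w → Dec (R u w)) → (∀ u w → R u w ⇔ R₀ u w) → Invariant R₀ R
  invariant-start R? eqv = record
    { rejected? = R?
    ; initial   = Equivalence.from (eqv _ _)
    ; reason    = inj₁ ∘ Equivalence.to (eqv _ _)
    ; unstable  = λ _ avoids r → avoids (Equivalence.to (eqv _ _) r) }

  module _ {R₀ R : PairRel n m} (inv : Invariant R₀ R) where
    open Invariant inv

    first-choice : ∀ {u w} → u ∈ U → w ∈ W → ¬ R u w →
                   ∃[ w′ ] (Proposes R u w′ × AtLeast P u w′ w)
    first-choice {u} {w} u∈ w∈ ¬r
      with best-satisfying (manOrder u) (λ w′ → (w′ ∈? W) ×-dec ¬? (rejected? u w′)) (w∈ , ¬r)
    ... | w′ , (w′∈ , ¬r′) , ge , top =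
      w′ , (u∈ , w′∈ , ¬r′ , λ (w″ , w″∈ , p , ¬r″) → top w″ p (w″∈ , ¬r″)) , ge

    invariant-step : ∀ {R′} → (∀ u w → Dec (R′ u w)) → (∀ u w → R′ u w ⇔ Step R u w) →
                     Invariant R₀ R′
    invariant-step {R′} R′? eqv = record
      { rejected? = R′?
      ; initial = into ∘ initial
      ; reason = reason′
      ; unstable = unstable′
      }
      where
      into : ∀ {u w} → R u w → R′ u w
      into r = Equivalence.from (eqv _ _) (inj₁ r)

      cause : ∀ {u w} → R′ u w → R₀ u w ⊎ Outbid (Proposes R) u w
      cause r = [ reason , (λ (_ , _ , o) → inj₂ o) ] (Equivalence.to (eqv _ _) r)

      -- The best current proposer of w is kept, so he outbids everybody w has ever rejected.
      reason′ : ∀ {u w} → R′ u w → R₀ u w ⊎ Outbid (Proposes R′) u w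
      reason′ {u} {w} r with cause r
      ... | inj₁ r₀ = inj₁ r₀
      ... | inj₂ (u′ , u′∈ , p , pr)
        with best-satisfying (womanOrder w) (λ x → proposes? rejected? x w) pr
      ...   | u* , (u*∈ , w∈ , ¬r , top) , ge , bestᵘ = inj₂ (u* , u*∈ , better ge , u*∈ , w∈ , kept ,
                λ (w′ , w′∈ , q , ¬r′) → top (w′ , w′∈ , q , ¬r′ ∘ into))
        where
        better : u* ≡ u′ ⊎ WomanPrefers w u* u′ → WomanPrefers w u* u
        better (inj₁ refl) = p
        better (inj₂ q)    = WO.trans w q p

        kept : ¬ R′ u* w
        kept r′ with cause r′
        ... | inj₁ r₀ = ¬r (initial r₀)
        ... | inj₂ (u″ , _ , q , pr″) = bestᵘ u″ q pr″

      -- Suppose `M` pairs `w` with a man who is outbid by the proposer `u′`. By stability `u′` has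
      -- someone better than `w` in `M`; by the invariant for `R` she has not rejected him, so `w`
      -- was not his first choice.
      unstable′ : ∀ {M} → Stable P U W M → Avoids R₀ M → Avoids R′ M
      unstable′ st avoids r′ m with Equivalence.to (eqv _ _) r′
      ... | inj₁ r = unstable st avoids r m
      ... | inj₂ (u∈ , w∈ , u′ , u′∈ , p , (_ , _ , ¬r , top)) with Stable.settled st u′∈ w∈
      ...   | inj₁ m′ with refl ← Stable.man! st m m′ = WO.irrefl _ refl p
      ...   | inj₂ (inj₁ (w′ , m′ , q)) =
              top (w′ , Stable.woman∈ st m′ , q , λ r → unstable st avoids r m′)
      ...   | inj₂ (inj₂ (u″ , m″ , q)) with refl ← Stable.man! st m m″ = WO.asym _ p q

    module _ (fixed : Fixed R) where

      proposes-wife! : ∀ {u w w′} → Proposes R u w → Proposes R u w′ → w ≡ w′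
      proposes-wife! {u} {w} {w′} (_ , w∈ , ¬r , top) (_ , w′∈ , ¬r′ , top′) with MO.compare u w w′
      ... | tri< p _ _ = contradiction (w , w∈ , p , ¬r) top′
      ... | tri≈ _ p _ = p
      ... | tri> _ _ p = contradiction (w′ , w′∈ , p , ¬r′) top

      proposes-man! : ∀ {u u′ w} → Proposes R u w → Proposes R u′ w → u ≡ u′
      proposes-man! {u} {u′} {w} pr@(u∈ , w∈ , ¬r , _) pr′@(u′∈ , _ , ¬r′ , _) with WO.compare w u u′
      ... | tri< p _ _ = contradiction (fixed u′∈ w∈ (u , u∈ , p , pr)) ¬r′
      ... | tri≈ _ p _ = p
      ... | tri> _ _ p = contradiction (fixed u∈ w∈ (u′ , u′∈ , p , pr′)) ¬r

      Settled : PairRel n m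
      Settled u w = Proposes R u w ⊎ (∃[ w′ ] (Proposes R u w′ × ManPrefers u w′ w))
                                   ⊎ (∃[ u′ ] (Proposes R u′ w × WomanPrefers w u′ u))

      -- A pair rejected in some round is settled by the proposer who outbids it. A pair excluded
      -- from the outset has no such witness, so it must be settled by an argument specific to `R₀`.
      outcome-stable : (∀ {u w} → u ∈ U → w ∈ W → R₀ u w → Settled u w) → Stable P U W (Proposes R)
      outcome-stable settle₀ = record
        { decide = proposes? rejected?
        ; man∈ = proj₁ ; woman∈ = proj₁ ∘ proj₂
        ; wife! = proposes-wife! ; man! = proposes-man!
        ; settled = settle }
        where
        settle : ∀ {u w} → u ∈ U → w ∈ W → Settled u w
        settle {u} {w} u∈ w∈ with rejected? u w
        ... | yes r with reason r
        ...   | inj₁ r₀ = settle₀ u∈ w∈ r₀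
        ...   | inj₂ (u′ , _ , p , pr) = inj₂ (inj₂ (u′ , pr , p))
        settle u∈ w∈ | no ¬r with first-choice u∈ w∈ ¬r
        ...   | w′ , pr , inj₁ refl = inj₁ pr
        ...   | w′ , pr , inj₂ p    = inj₂ (inj₁ (w′ , pr , p))

      module _ {M} (st : Stable P U W M) (avoids : Avoids R₀ M) where
        open Stable st

        abstract
          outcome-optimal : ∀ {u w} → M u w → ∃[ w′ ] (Proposes R u w′ × AtLeast P u w′ w)
          outcome-optimal m = first-choice (man∈ m) (woman∈ m) λ r → unstable st avoids r m

        -- Send each woman matched in `M` to the woman to whom her `M`-partner finally proposes. If
        -- he prefers the new woman, she too is matched in `M`, as they would otherwise block it.
        -- This is an injective map of the women matched in `M` to themselves, so all of them are
        -- hit.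
        outcome-covers : ∀ {u w} → M u w → ∃[ u′ ] Proposes R u′ w
        outcome-covers {u} {w} m
          with injective-on⇒hits {T = λ w w′ → ∃[ u ] (M u w × Proposes R u w′)}
                 (λ w → any? λ u → decide u w) image
                 (λ (u , m , pr) (u′ , m′ , pr′) → same (proposes-man! pr pr′) m m′) (u , m)
          where
          same : ∀ {u u′ w w′} → u ≡ u′ → M u w → M u′ w′ → w ≡ w′
          same refl = wife!

          image : ∀ {w} → (∃[ u ] M u w) →
                  ∃[ w′ ] ((∃[ u ] M u w′) × ∃[ u ] (M u w × Proposes R u w′))
          image {w} (u , m) with outcome-optimal m
          ... | w′ , pr , inj₁ refl = w′ , (u , m) , u , m , pr
          ... | w′ , pr , inj₂ p with settled (man∈ m) (proj₁ (proj₂ pr))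
          ...   | inj₁ m′ = w′ , (u , m′) , u , m , pr
          ...   | inj₂ (inj₁ (w″ , m″ , q)) with refl ← wife! m m″ = contradiction q (MO.asym u p)
          ...   | inj₂ (inj₂ (u″ , m″ , _)) = w′ , (u″ , m″) , u , m , pr
        ... | _ , _ , u′ , _ , pr = u′ , pr

-- The women propose, and every man refuses the women he likes less than his partner in M₁.

module Truncation {n m} (P : Preferences n m) {U₁ U₂ : Subset n} {W₁ W₂ : Subset m}
                  (U₂⊆U₁ : U₂ ⊆ U₁) (W₁⊆W₂ : W₁ ⊆ W₂)
                  {M₁ : PairRel n m} (st₁ : Stable P U₁ W₁ M₁) where
  open Preferences P
  open DeferredAcceptance (dual P) W₂ U₂
  private module MO u = IsStrictTotalOrder (manOrder u)

  Refused : PairRel m n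
  Refused w u = w ∈ W₂ × u ∈ U₂ × ∃[ w′ ] (M₁ u w′ × ManPrefers u w′ w)

  module _ {R} (inv : Invariant Refused R) (fixed : Fixed R) where

    module _ {M₂} (st₂ : Stable P U₂ W₂ M₂) where
      open Join P U₂⊆U₁ W₁⊆W₂ st₁ st₂

      join-avoids : Avoids Refused (flip join)
      join-avoids (_ , _ , w′ , m₁ , p) J = not-preferred P (join-atLeast₁ J w′ m₁) p

      abstract
        -- The join is stable, matches `u` and contains no refused pair, so `outcome-covers`,
        -- applied with the sides exchanged, gives `u` a proposal; not being refused, it is no worse
        -- than his `M₁`-partner.
        improves : ∀ {u w} → u ∈ U₂ → M₁ u w → ∃[ w′ ] (Proposes R w′ u × AtLeast P u w′ w)
        improves {u} {w} u∈ m₁ with join-partner u∈ (inj₁ (w , m₁))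
        ... | j , J with outcome-covers inv fixed (Stable-dual join-stable) join-avoids J
        ...   | w′ , pr@(w′∈ , _ , ¬r , _) with atLeast? P u w′ w
        ...     | yes p = w′ , pr , p
        ...     | no ¬p = contradiction (Invariant.initial inv (w′∈ , u∈ , w , m₁ , not-atLeast P ¬p)) ¬r

      -- The join gives `w` to `u`, and the outcome gives him some `w′` at least as good. Were `w′`
      -- better, she would have in the join a man she prefers to `u`. But the outcome is best for
      -- the women among the stable matchings without refused pairs, so she could not end up with
      -- `u`.
      keeps-common : ∀ {u w} → M₁ u w → M₂ u w → Proposes R w u
      keeps-common {u} {w} m₁ m₂ = result
        where
        u∈ = Stable.man∈ st₂ m₂
        J : join u w
        J = u∈ , inj₁ (m₁ , λ w′ m₂′ → inj₁ (Stable.wife! st₂ m₂ m₂′))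

        result : Proposes R w u
        result with improves u∈ m₁
        ... | _ , pr , inj₁ refl = pr
        ... | w′ , pr , inj₂ p with Stable.settled join-stable u∈ (proj₁ pr)
        ...   | inj₁ J′ with refl ← Stable.wife! join-stable J J′ = contradiction p (MO.irrefl u refl)
        ...   | inj₂ (inj₁ (_ , J′ , q)) with refl ← Stable.wife! join-stable J J′ =
                contradiction q (MO.asym u p)
        ...   | inj₂ (inj₂ (u′ , J′ , q)) with outcome-optimal inv fixed (Stable-dual join-stable) join-avoids J′
        ...     | _ , pr′ , ge with refl ← proposes-wife! inv fixed pr pr′ =
                  contradiction q (not-preferred (dual P) ge)

    -- A refused pair does not block, because the man ends up at least as well as with the partner
    -- for whose sake he refused. `N` supplies the join behind `improves`.
    truncated-stable : ∀ {N} → Stable P U₂ W₂ N → Stable P U₂ W₂ (flip (Proposes R))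
    truncated-stable stN = Stable-dual (outcome-stable inv fixed settle₀)
      where
      settle₀ : ∀ {w u} → w ∈ W₂ → u ∈ U₂ → Refused w u → Settled inv fixed w u
      settle₀ {w} {u} w∈ u∈ (_ , _ , w′ , m₁ , p) with improves stN u∈ m₁
      ... | w″ , pr , inj₁ refl = inj₂ (inj₂ (w″ , pr , p))
      ... | w″ , pr , inj₂ q    = inj₂ (inj₂ (w″ , pr , MO.trans u q p))

-- Stability of sets of pairs

module _ {n m} {Q : PairRel n m} (Q? : ∀ u w → Dec (Q u w)) where

  pairSet : PairSet n m
  pairSet = tabulate λ u → tabulate λ w → does (Q? u w)

  private
    lookup-pairSet : ∀ u w → lookup (lookup pairSet u) w ≡ does (Q? u w)
    lookup-pairSet u w = trans (cong (λ r → lookup r w) (lookup∘tabulate _ u)) (lookup∘tabulate _ w)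

  ∈-pairSet : ∀ u w → ⟨ u , w ⟩∈ pairSet ⇔ Q u w
  ∈-pairSet u w = mk⇔
    (λ e → witness (trans (sym (lookup-pairSet u w)) ([]=⇒lookup e)))
    (λ q → lookup⇒[]= w _ (trans (lookup-pairSet u w) (dec-true (Q? u w) q)))
    where
    witness : does (Q? u w) ≡ true → Q u w
    witness eq with Q? u w
    ... | yes q = q

module _ {n m} {P : Preferences n m} {U : Subset n} {W : Subset m} {M : PairSet n m} where
  open Preferences P
  private
    module MO u = IsStrictTotalOrder (manOrder u)
    module WO w = IsStrictTotalOrder (womanOrder w)

  toStable : IsStable P U W M → Stable P U W (λ u w → ⟨ u , w ⟩∈ M)
  toStable st = record
    { decide = λ u w → w ∈? lookup M u
    ; man∈ = proj₁ ∘ within ; woman∈ = proj₂ ∘ within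
    ; wife! = uniqueWoman ; man! = uniqueMan
    ; settled = settled
    }
    where
    open IsStable st
    open IsMatching isMatching

    settled : ∀ {u w} → u ∈ U → w ∈ W →
              ⟨ u , w ⟩∈ M ⊎ (∃[ w′ ] (⟨ u , w′ ⟩∈ M × ManPrefers u w′ w))
                           ⊎ (∃[ u′ ] (⟨ u′ , w ⟩∈ M × WomanPrefers w u′ u))
    settled {u} {w} u∈ w∈ with w ∈? lookup M u
      | any? (λ w′ → (w′ ∈? lookup M u) ×-dec MO._<?_ u w′ w)
      | any? (λ u′ → (w ∈? lookup M u′) ×-dec WO._<?_ w u′ u)
    ... | yes e | _     | _     = inj₁ e
    ... | no _  | yes e | _     = inj₂ (inj₁ e)
    ... | no _  | no _  | yes e = inj₂ (inj₂ e)
    ... | no ¬m | no ¬b | no ¬c = contradiction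
            (record { man∈ = u∈ ; woman∈ = w∈ ; notPaired = ¬m ; manWants = manWants ; womanWants = womanWants })
            (noBlocking u w)
      where
      manWants : ¬ (∃[ w′ ] ⟨ u , w′ ⟩∈ M) ⊎ (∃[ w′ ] (⟨ u , w′ ⟩∈ M × ManPrefers u w w′))
      manWants with any? (λ w′ → w′ ∈? lookup M u)
      ... | no single = inj₁ single
      ... | yes (w′ , m′) with MO.compare u w w′
      ...   | tri< p _ _    = inj₂ (w′ , m′ , p)
      ...   | tri≈ _ refl _ = contradiction m′ ¬m
      ...   | tri> _ _ p    = contradiction (w′ , m′ , p) ¬b

      womanWants : ¬ (∃[ u′ ] ⟨ u′ , w ⟩∈ M) ⊎ (∃[ u′ ] (⟨ u′ , w ⟩∈ M × WomanPrefers w u u′))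
      womanWants with any? (λ u′ → w ∈? lookup M u′)
      ... | no single = inj₁ single
      ... | yes (u′ , m′) with WO.compare w u u′
      ...   | tri< p _ _    = inj₂ (u′ , m′ , p)
      ...   | tri≈ _ refl _ = contradiction m′ ¬m
      ...   | tri> _ _ p    = contradiction (u′ , m′ , p) ¬c

  fromStable : ∀ {Q} → Stable P U W Q → (∀ u w → ⟨ u , w ⟩∈ M ⇔ Q u w) → IsStable P U W M
  fromStable {Q} st eqv = record
    { isMatching = record
        { within = λ e → man∈ (to e) , woman∈ (to e)
        ; uniqueWoman = λ e e′ → wife! (to e) (to e′)
        ; uniqueMan = λ e e′ → man! (to e) (to e′) }
    ; noBlocking = λ u w b → refute (settled (IsBlockingPair.man∈ b) (IsBlockingPair.woman∈ b)) b
    }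
    where
    open Stable st
    to : ∀ {u w} → ⟨ u , w ⟩∈ M → Q u w
    to = Equivalence.to (eqv _ _)
    from : ∀ {u w} → Q u w → ⟨ u , w ⟩∈ M
    from = Equivalence.from (eqv _ _)

    refute : ∀ {u w} → Q u w ⊎ (∃[ w′ ] (Q u w′ × ManPrefers u w′ w))
                             ⊎ (∃[ u′ ] (Q u′ w × WomanPrefers w u′ u)) → ¬ IsBlockingPair P U W M u w
    refute (inj₁ q) b = IsBlockingPair.notPaired b (from q)
    refute (inj₂ (inj₁ (w′ , q , p))) b with IsBlockingPair.manWants b
    ... | inj₁ single = single (w′ , from q)
    ... | inj₂ (w″ , e , p′) with refl ← wife! q (to e) = MO.asym _ p p′
    refute (inj₂ (inj₂ (u′ , q , p))) b with IsBlockingPair.womanWants b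
    ... | inj₁ single = single (u′ , from q)
    ... | inj₂ (u″ , e , p′) with refl ← man! q (to e) = WO.asym _ p p′

-- Sizes and weights

sum-mono : ∀ {n} {f g : Fin n → ℕ} → (∀ i → f i ≤ g i) → sum f ≤ sum g
sum-mono {zero}  f≤g = z≤n
sum-mono {suc n} f≤g = +-mono-≤ (f≤g zero) (sum-mono (f≤g ∘ suc))

∣─∣+weight : ∀ {m} (p q : Subset m) →
             ∣ p ─ q ∣ + sum (λ w → if does (w ∈? q) then (if does (w ∈? p) then 1 else 0) else 0) ≡ ∣ p ∣
∣─∣+weight []            []            = refl
∣─∣+weight (inside  ∷ p) (inside  ∷ q) = trans (+-suc _ _) (cong suc (∣─∣+weight p q))
∣─∣+weight (outside ∷ p) (inside  ∷ q) = ∣─∣+weight p q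
∣─∣+weight (inside  ∷ p) (outside ∷ q) = cong suc (∣─∣+weight p q)
∣─∣+weight (outside ∷ p) (outside ∷ q) = ∣─∣+weight p q

-- The right side does not depend on `N`: maximizing the weight of `N` is minimizing the number of
-- pairs of `M` lost.
size-∖+weight : ∀ {n m} (M N : PairSet n m) →
                size (M ∖ N) + totalWeight (indicator M) N ≡ size M
size-∖+weight M N = trans (sym (∑-distrib-+ (λ u → ∣ lookup (M ∖ N) u ∣) rowWeight)) (sum-cong-≗ row)
  where
  rowWeight : Fin _ → ℕ
  rowWeight u = sum λ w → if does (w ∈? lookup N u) then indicator M u w else 0

  row : ∀ u → ∣ lookup (M ∖ N) u ∣ + rowWeight u ≡ ∣ lookup M u ∣
  row u = trans (cong (λ r → ∣ r ∣ + rowWeight u) (lookup-zipWith _─_ u M N))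
                (∣─∣+weight (lookup M u) (lookup N u))

weight-mono : ∀ {n m} {M N N′ : PairSet n m} →
              (∀ {u w} → ⟨ u , w ⟩∈ M → ⟨ u , w ⟩∈ N → ⟨ u , w ⟩∈ N′) →
              totalWeight (indicator M) N ≤ totalWeight (indicator M) N′
weight-mono {M = M} {N} {N′} common = sum-mono λ u → sum-mono λ w → cell≤ u w
  where
  cell≤ : ∀ u w → (if does (w ∈? lookup N u) then indicator M u w else 0)
                ≤ (if does (w ∈? lookup N′ u) then indicator M u w else 0)
  cell≤ u w with w ∈? lookup N u | w ∈? lookup M u | w ∈? lookup N′ u
  ... | no _  | _     | _      = z≤n
  ... | yes _ | no _  | _      = z≤n
  ... | yes n | yes k | yes _  = s≤s z≤n
  ... | yes n | yes k | no ¬n′ = contradiction (common k n) ¬n′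

-- Rows of a matching have at most one element, so comparing their sizes amounts to an implication
-- between being nonempty.
subsingleton-≤ : ∀ {m} {p q : Subset m} → (∀ {w w′} → w ∈ p → w′ ∈ p → w ≡ w′) →
                 (Nonempty p → Nonempty q) → ∣ p ∣ ≤ ∣ q ∣
subsingleton-≤ {p = p} {q} unique nonempty with nonempty? p
... | no empty = p⊆q⇒∣p∣≤∣q∣ {q = q} λ x∈ → contradiction (_ , x∈) empty
... | yes (x , x∈) with nonempty (x , x∈)
...   | y , y∈ = ≤-trans (p⊆q⇒∣p∣≤∣q∣ λ {z} z∈ → subst (_∈ _) (unique x∈ z∈) (x∈⁅x⁆ x))
                 (≤-trans (≤-reflexive (trans (∣⁅x⁆∣≡1 x) (sym (∣⁅x⁆∣≡1 y))))
                 (p⊆q⇒∣p∣≤∣q∣ {q = q} λ {z} z∈ → subst (_∈ q) (sym (x∈⁅y⁆⇒x≡y y z∈)) y∈))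

∈-∖⁺ : ∀ {n m} {M N : PairSet n m} {u w} → ⟨ u , w ⟩∈ M → ¬ ⟨ u , w ⟩∈ N → ⟨ u , w ⟩∈ M ∖ N
∈-∖⁺ {M = M} {N} {u} m ¬n = subst (_ ∈_) (sym (lookup-zipWith _─_ u M N)) (x∈p∧x∉q⇒x∈p─q m ¬n)

∈-∖⁻ : ∀ {n m} {M N : PairSet n m} {u w} → ⟨ u , w ⟩∈ M ∖ N → ⟨ u , w ⟩∈ M × ¬ ⟨ u , w ⟩∈ N
∈-∖⁻ {M = M} {N} {u} {w} e = p─q⊆p _ _ e′ , notin (lookup M u) (lookup N u) w e′
  where
  e′ : w ∈ lookup M u ─ lookup N u
  e′ = subst (w ∈_) (lookup-zipWith _─_ u M N) e

  notin : ∀ {m} (p q : Subset m) w → w ∈ p ─ q → ¬ w ∈ q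
  notin (_ ∷ p) (inside ∷ q)  zero () here
  notin (_ ∷ p) (_ ∷ q) (suc w) (there e) (there f) = notin p q w e f

online-optimal : ∀ {n m : ℕ} (P : Preferences n m) (U₂ : Subset n) (W₁ : Subset m)
                 (M₁* M₂* : PairSet n m) →
                 IsMenOptimal P ⊤ W₁ M₁* → IsMaxWeightStable P U₂ ⊤ (indicator M₁*) M₂* →
                 ∀ (M₁ M₂ : PairSet n m) → IsStable P ⊤ W₁ M₁ → IsStable P U₂ ⊤ M₂ →
                 size (M₁* ∖ M₂*) ≤ size (M₁ ∖ M₂)
online-optimal P U₂ W₁ M₁* M₂* opt max M₁ M₂ is₁ is₂ = ≤-trans step₁ step₂
  where
  module Max = IsMaxWeightStable max
  module Opt = IsMenOptimal opt
  st₁* = toStable Opt.isStable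
  st₁  = toStable is₁
  st₂  = toStable is₂
  open Join P ⊆⊤ ⊆⊤ st₁* st₂

  N : PairSet _ _
  N = pairSet (Stable.decide join-stable)

  ∈N : ∀ u w → ⟨ u , w ⟩∈ N ⇔ join u w
  ∈N = ∈-pairSet (Stable.decide join-stable)

  step₁ : size (M₁* ∖ M₂*) ≤ size (M₁* ∖ N)
  step₁ = +-cancelʳ-≤ (totalWeight (indicator M₁*) N) _ _ (begin
    size (M₁* ∖ M₂*) + totalWeight (indicator M₁*) N   ≤⟨ +-monoʳ-≤ (size (M₁* ∖ M₂*)) (Max.maximal N (fromStable join-stable ∈N)) ⟩
    size (M₁* ∖ M₂*) + totalWeight (indicator M₁*) M₂* ≡⟨ size-∖+weight M₁* M₂* ⟩
    size M₁*                                           ≡⟨ size-∖+weight M₁* N ⟨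
    size (M₁* ∖ N) + totalWeight (indicator M₁*) N     ∎)
    where open ≤-Reasoning

  -- A common partner in M₁ and M₂ is no better than the one in M₁*, which the join then keeps.
  step₂ : size (M₁* ∖ N) ≤ size (M₁ ∖ M₂)
  step₂ = sum-mono λ u → subsingleton-≤
    (λ e e′ → Stable.wife! st₁* (proj₁ (∈-∖⁻ {M = M₁*} {N} e)) (proj₁ (∈-∖⁻ {M = M₁*} {N} e′)))
    (λ (w , e) → lost u w (∈-∖⁻ {M = M₁*} {N} e))
    where
    lost : ∀ u w → ⟨ u , w ⟩∈ M₁* × ¬ ⟨ u , w ⟩∈ N → Nonempty (lookup (M₁ ∖ M₂) u)
    -- The join machinery is used here with both matchings in the same first-stage market.
    lost u w (m* , ∉N) with Join.stays-matched P ⊆⊤ (λ x → x) st₁* st₁ (Stable.man∈ st₁* m*) m*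
    ... | w₁ , m₁ = w₁ , ∈-∖⁺ {M = M₁} {M₂} m₁ λ m₂ → ∉N (Equivalence.from (∈N u w)
          (Stable.man∈ st₂ m₂ , inj₁ (m* , λ w₂ m₂′ →
            subst (AtLeast P u w) (Stable.wife! st₂ m₂ m₂′) (beats m₂))))
      where
      beats : ⟨ u , w₁ ⟩∈ M₂ → AtLeast P u w w₁
      beats m₂ with Opt.best u w₁ (M₁ , is₁ , m₁)
      ... | w* , m*′ , ge with refl ← Stable.wife! st₁* m* m*′ = ge

-- A language of bounded loops.  The loop variable v is the cell (v , 0 , 0); it runs down
-- from (0 , i , 0) ∸ 1 to 0.

infixr 4 _▸_

data Stmt : Set where
  set  : (t : ℕ) (i j e : Expr) → Stmt
  _▸_  : Stmt → Stmt → Stmt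
  when : Expr → Stmt → Stmt
  for  : (v i : ℕ) → Stmt → Stmt

var : ℕ → Expr
var v = cell v (lit 0) (lit 0)

compile : Stmt → Program
compile (set t i j e) = assign t i j e
compile (c ▸ d)       = compile c ⨾ compile d
compile (when e c)    = ifElse e (compile c) skip
compile (for v i c)   =
  assign v (lit 0) (lit 0) (cell 0 (lit i) (lit 0)) ⨾
  while (var v) (assign v (lit 0) (lit 0) (var v ⊖ lit 1) ⨾ compile c)

unless0 : ℕ → Store → Store → Store
unless0 zero    s s′ = s
unless0 (suc _) s s′ = s′

countdown : (Store → Store) → ℕ → ℕ → Store → Store
countdown f v zero    s = s
countdown f v (suc k) s = countdown f v k (f (update s v 0 0 k))

exec : Stmt → Store → Store
exec (set t i j e) s = update s t (eval s i) (eval s j) (eval s e)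
exec (c ▸ d)       s = exec d (exec c s)
exec (when e c)    s = unless0 (eval s e) s (exec c s)
exec (for v i c)   s = countdown (exec c) v (s 0 i 0) (update s v 0 0 (s 0 i 0))

-- A loop variable counts as a single cell, not as an array. Stores that agree outside what a loop
-- touches must agree outside what its body touches once the variable is set, and `update-agree`
-- would fail if all of array `v` counted as touched.
touches : Stmt → ℕ → ℕ → ℕ → Bool
touches (set t _ _ _) b p q = t ≡ᵇ b
touches (c ▸ d)       b p q = touches c b p q ∨ touches d b p q
touches (when _ c)    b p q = touches c b p q
touches (for v _ c)   b p q = ((v ≡ᵇ b) ∧ (0 ≡ᵇ p) ∧ (0 ≡ᵇ q)) ∨ touches c b p q

-- For a concrete program this computes to a product of unit types, so such conditions are solved by
-- `_`. The same holds for `Runnable` and `Sweep`.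
Fresh : ℕ → Stmt → Set
Fresh b (set t _ _ _) = T (not (t ≡ᵇ b))
Fresh b (c ▸ d)       = Fresh b c × Fresh b d
Fresh b (when _ c)    = Fresh b c
Fresh b (for v _ c)   = T (not (v ≡ᵇ b)) × Fresh b c

T-not⇒≡false : ∀ {b} → T (not b) → b ≡ false
T-not⇒≡false {false} _ = refl

fresh⇒untouched : ∀ c {b} → Fresh b c → ∀ p q → touches c b p q ≡ false
fresh⇒untouched (set t _ _ _) fr p q = T-not⇒≡false fr
fresh⇒untouched (c ▸ d) (fr , fr′) p q
  rewrite fresh⇒untouched c fr p q = fresh⇒untouched d fr′ p q
fresh⇒untouched (when _ c) fr p q = fresh⇒untouched c fr p q
fresh⇒untouched (for v _ c) (v≢b , fr) p q
  rewrite T-not⇒≡false v≢b = fresh⇒untouched c fr p q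

≡ᵇ-refl : ∀ k → (k ≡ᵇ k) ≡ true
≡ᵇ-refl zero    = refl
≡ᵇ-refl (suc k) = ≡ᵇ-refl k

update-hit : ∀ s a i j x → update s a i j x a i j ≡ x
update-hit s a i j x rewrite ≡ᵇ-refl a | ≡ᵇ-refl i | ≡ᵇ-refl j = refl

update-other-array : ∀ s a i j {x b} p q → (a ≡ᵇ b) ≡ false → update s a i j x b p q ≡ s b p q
update-other-array s a i j p q eq rewrite eq = refl

update-other-cell : ∀ s a {x b p q} → ((a ≡ᵇ b) ∧ (0 ≡ᵇ p) ∧ (0 ≡ᵇ q)) ≡ false →
                    update s a 0 0 x b p q ≡ s b p q
update-other-cell s a eq rewrite eq = refl

frame : ∀ c s {b p q} → touches c b p q ≡ false → exec c s b p q ≡ s b p q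
frame (set t i j e) s {p = p} {q} eq = update-other-array s t (eval s i) (eval s j) p q eq
frame (c ▸ d) s {b} {p} {q} eq =
  trans (frame d (exec c s) (∨-conicalʳ (touches c b p q) _ eq)) (frame c s (∨-conicalˡ _ _ eq))
frame (when e c) s eq with eval s e
... | zero  = refl
... | suc _ = frame c s eq
frame (for v i c) s {b} {p} {q} eq =
  trans (go (s 0 i 0) (update s v 0 0 (s 0 i 0))) (update-other-cell s v (∨-conicalˡ ((v ≡ᵇ b) ∧ (0 ≡ᵇ p) ∧ (0 ≡ᵇ q)) _ eq))
  where
  go : ∀ k s → countdown (exec c) v k s b p q ≡ s b p q
  go zero    s = refl
  go (suc k) s = trans (go k _)
    (trans (frame c (update s v 0 0 k) (∨-conicalʳ ((v ≡ᵇ b) ∧ (0 ≡ᵇ p) ∧ (0 ≡ᵇ q)) _ eq))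
           (update-other-cell s v (∨-conicalˡ ((v ≡ᵇ b) ∧ (0 ≡ᵇ p) ∧ (0 ≡ᵇ q)) _ eq)))

-- Running time

Runnable : Stmt → Set
Runnable (set _ _ _ _) = Unit
Runnable (c ▸ d)       = Runnable c × Runnable d
Runnable (when _ c)    = Runnable c
Runnable (for v _ c)   = Fresh v c × Runnable c

-- The running time is at most `factor c * N ^ degree c` if `N` bounds all loop bounds. In `when`, 2
-- covers the test and a `skip`; in `for`, 2 covers the initial assignment and the last test, and 2
-- more the test and the decrement of each iteration. Adding degrees in a sequence is generous but
-- avoids maxima.
factor degree : Stmt → ℕ
factor (set _ _ _ _) = 1
factor (c ▸ d)       = factor c + factor d
factor (when _ c)    = 2 + factor c
factor (for _ _ c)   = 4 + factor c
degree (set _ _ _ _) = 0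
degree (c ▸ d)       = degree c + degree d
degree (when _ c)    = degree c
degree (for _ _ c)   = suc (degree c)

module _ (N : ℕ) .{{_ : NonZero N}} where

  private
    1≤^ : ∀ d → 1 ≤ N ^ d
    1≤^ d = m^n>0 N d

    bound : Stmt → ℕ
    bound c = factor c * N ^ degree c

    seq-bound : ∀ c d → bound c + bound d ≤ bound (c ▸ d)
    seq-bound c d = begin
      factor c * N ^ degree c + factor d * N ^ degree d
        ≤⟨ +-mono-≤ (*-monoʳ-≤ (factor c) (^-monoʳ-≤ N (m≤m+n (degree c) (degree d))))
                    (*-monoʳ-≤ (factor d) (^-monoʳ-≤ N (m≤n+m (degree d) (degree c)))) ⟩
      factor c * N ^ (degree c + degree d) + factor d * N ^ (degree c + degree d)
        ≡⟨ *-distribʳ-+ (N ^ (degree c + degree d)) (factor c) (factor d) ⟨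
      (factor c + factor d) * N ^ (degree c + degree d) ∎
      where open ≤-Reasoning

    when-bound : ∀ e c → 2 + bound c ≤ bound (when e c)
    when-bound e c = begin
      2 + bound c                              ≤⟨ +-monoˡ-≤ (bound c) (*-monoʳ-≤ 2 (1≤^ (degree c))) ⟩
      2 * N ^ degree c + factor c * N ^ degree c ≡⟨ *-distribʳ-+ (N ^ degree c) 2 (factor c) ⟨
      (2 + factor c) * N ^ degree c            ∎
      where open ≤-Reasoning

    for-bound : ∀ v i c {k} → k ≤ N → 2 + k * (2 + bound c) ≤ bound (for v i c)
    for-bound v i c {k} k≤N = begin
      2 + k * (2 + bound c)              ≤⟨ +-monoʳ-≤ 2 (*-monoˡ-≤ (2 + bound c) k≤N) ⟩
      2 + N * (2 + factor c * X)         ≤⟨ +-mono-≤ (*-monoʳ-≤ 2 (*-mono-≤ (>-nonZero⁻¹ N) (1≤^ (degree c))))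
                                              (*-monoʳ-≤ N (+-monoˡ-≤ (factor c * X) (*-monoʳ-≤ 2 (1≤^ (degree c))))) ⟩
      2 * (N * X) + N * (2 * X + factor c * X) ≡⟨ solve 3 (λ n x f → con 2 :* (n :* x) :+ n :* (con 2 :* x :+ f :* x)
                                                     := (con 4 :+ f) :* (n :* x)) refl N X (factor c) ⟩
      (4 + factor c) * (N * X)           ∎
      where
      open ≤-Reasoning
      open +-*-Solver
      X = N ^ degree c

  compile-runs : ∀ c s → Fresh 0 c → Runnable c → (∀ i → s 0 i 0 ≤ N) →
                 ∃[ t ] (Run (compile c) s (exec c s) t × t ≤ factor c * N ^ degree c)
  compile-runs (set t i j e) s _ _ _ = 1 , run-assign , ≤-refl
  compile-runs (c ▸ d) s (fr , fr′) (ok , ok′) small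
    with t , r , t≤ ← compile-runs c s fr ok small
    with t′ , r′ , t′≤ ← compile-runs d (exec c s) fr′ ok′
           (λ i → subst (_≤ N) (sym (frame c s (fresh⇒untouched c fr i 0))) (small i)) =
    t + t′ , run-seq r r′ , ≤-trans (+-mono-≤ t≤ t′≤) (seq-bound c d)
  compile-runs (when e c) s fr ok small with eval s e in eq
  ... | zero  = 2 , run-else eq run-skip , ≤-trans (m≤m+n 2 (bound c)) (when-bound e c)
  ... | suc k with t , r , t≤ ← compile-runs c s fr ok small =
    suc t , run-then (λ z → contradiction (trans (sym eq) z) λ ()) r ,
    ≤-trans (m≤n⇒m≤1+n (s≤s t≤)) (when-bound e c)
  compile-runs (for v i c) s (v≢0 , fr) (fv , ok) small = result
    where
    preserved : ∀ k s → (∀ i → s 0 i 0 ≤ N) → ∀ i → update s v 0 0 k 0 i 0 ≤ N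
    preserved k s small i = subst (_≤ N) (sym (update-other-array s v 0 0 i 0 (T-not⇒≡false v≢0))) (small i)

    loop : ∀ k s → s v 0 0 ≡ k → (∀ i → s 0 i 0 ≤ N) →
           ∃[ t ] (Run (while (var v) (assign v (lit 0) (lit 0) (var v ⊖ lit 1) ⨾ compile c))
                       s (countdown (exec c) v k s) t × t ≤ 1 + k * (2 + bound c))
    loop zero    s eq small = 1 , run-stop eq , s≤s z≤n
    loop (suc k) s eq small
      with t , r , t≤ ← compile-runs c (update s v 0 0 k) fr ok (preserved k s small)
      with t′ , r′ , t′≤ ← loop k (exec c (update s v 0 0 k))
             (trans (frame c _ (fresh⇒untouched c fv 0 0)) (update-hit s v 0 0 k))
             (λ i → subst (_≤ N) (sym (frame c _ (fresh⇒untouched c fr i 0))) (preserved k s small i)) =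
      suc (suc t + t′) ,
      run-loop (λ z → contradiction (trans (sym eq) z) λ ())
        (run-seq (subst (λ x → Run _ s (update s v 0 0 x) 1) (cong (_∸ 1) eq) run-assign) r) r′ ,
      (begin
        suc (suc t + t′)                             ≤⟨ +-mono-≤ (s≤s (s≤s t≤)) t′≤ ⟩
        (2 + bound c) + (1 + k * (2 + bound c))      ≡⟨ +-suc (2 + bound c) _ ⟩
        1 + ((2 + bound c) + k * (2 + bound c))      ∎)
      where open ≤-Reasoning

    result : ∃[ t ] (Run (compile (for v i c)) s (exec (for v i c) s) t × t ≤ bound (for v i c))
    result with t , r , t≤ ← loop (s 0 i 0) (update s v 0 0 (s 0 i 0)) (update-hit s v 0 0 _)
                               (preserved (s 0 i 0) s small) =
      1 + t , run-seq run-assign r , ≤-trans (s≤s t≤) (for-bound v i c (small i))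

-- Sweeps: nested loops around a single assignment whose effects on different iterations
-- do not influence each other.

target : Stmt → ℕ
target (set t _ _ _) = t
target (c ▸ d)       = target c
target (when _ c)    = target c
target (for _ _ c)   = target c

Independent : Expr → Stmt → Set
Independent (lit _)      c = Unit
Independent (cell b i j) c = Fresh b c × Independent i c × Independent j c
Independent (e ⊕ f)      c = Independent e c × Independent f c
Independent (e ⊖ f)      c = Independent e c × Independent f c

Sweep : Stmt → Set
Sweep c@(set _ i j e) = Independent i c × Independent j c × Independent e c
Sweep (c ▸ d)         = ⊥
Sweep (when e c)      = Independent e c × Sweep c
Sweep (for v _ c)     = T (not (v ≡ᵇ 0)) × Fresh 0 c × T (not (v ≡ᵇ target c)) × Sweep c

-- Hit c s p q x: some iteration assigns x to the cell (p , q) of the target.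
Hit : Stmt → Store → ℕ → ℕ → ℕ → Set
Hit (set _ i j e) s p q x = p ≡ eval s i × q ≡ eval s j × x ≡ eval s e
Hit (c ▸ d)       s p q x = ⊥
Hit (when e c)    s p q x = eval s e ≢ 0 × Hit c s p q x
Hit (for v i c)   s p q x = ∃[ k ] (k < s 0 i 0 × Hit c (update s v 0 0 k) p q x)

Agree : Stmt → Store → Store → Set
Agree c s s′ = ∀ {b p q} → touches c b p q ≡ false → s b p q ≡ s′ b p q

eval-agree : ∀ {c s s′} e → Independent e c → Agree c s s′ → eval s e ≡ eval s′ e
eval-agree (lit k) _ ag = refl
eval-agree {c} {s} {s′} (cell b i j) (fr , ii , ij) ag =
  trans (ag (fresh⇒untouched c fr _ _)) (cong₂ (s′ b) (eval-agree i ii ag) (eval-agree j ij ag))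
eval-agree (e ⊕ f) (ie , if) ag = cong₂ _+_ (eval-agree e ie ag) (eval-agree f if ag)
eval-agree (e ⊖ f) (ie , if) ag = cong₂ _∸_ (eval-agree e ie ag) (eval-agree f if ag)

update-agree : ∀ {v i c s s′} k → Agree (for v i c) s s′ → Agree c (update s v 0 0 k) (update s′ v 0 0 k)
update-agree {v} k ag {b} {p} {q} eq with (v ≡ᵇ b) ∧ (0 ≡ᵇ p) ∧ (0 ≡ᵇ q) in c
... | true  = refl
... | false = ag (cong₂ _∨_ c eq)

≡ᵇ-true⇒≡ : ∀ {m n} → (m ≡ᵇ n) ≡ true → m ≡ n
≡ᵇ-true⇒≡ {m} {n} eq = ≡ᵇ⇒≡ m n (subst T (sym eq) tt)

≡ᵇ-false⇒≢ : ∀ {m n} → (m ≡ᵇ n) ≡ false → n ≢ m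
≡ᵇ-false⇒≢ {m} m≢n refl = contradiction (trans (sym (≡ᵇ-refl m)) m≢n) λ ()

-- Effects are judged in a reference store `s′`, while `s` is the current one: earlier iterations
-- change the target and the loop variables, but nothing on which later ones depend. A cell may be
-- written repeatedly, so only some iteration is credited with its final value.
sweep-spec : ∀ c {s s′} → Sweep c → Agree c s s′ → ∀ p q →
             Hit c s′ p q (exec c s (target c) p q) ⊎
             ((∀ x → ¬ Hit c s′ p q x) × exec c s (target c) p q ≡ s (target c) p q)
sweep-spec c@(set t i j e) {s} {s′} (ii , ij , ie) ag p q
  with eval s i ≡ᵇ p in p? | eval s j ≡ᵇ q in q?
... | true | true rewrite ≡ᵇ-refl t =
  inj₁ (trans (sym (≡ᵇ-true⇒≡ p?)) (eval-agree {c} i ii ag) ,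
        trans (sym (≡ᵇ-true⇒≡ q?)) (eval-agree {c} j ij ag) , eval-agree {c} e ie ag)
... | true | false rewrite ≡ᵇ-refl t =
  inj₂ ((λ x (_ , eq , _) → ≡ᵇ-false⇒≢ q? (trans eq (sym (eval-agree {c} j ij ag)))) , refl)
... | false | _ rewrite ≡ᵇ-refl t =
  inj₂ ((λ x (eq , _) → ≡ᵇ-false⇒≢ p? (trans eq (sym (eval-agree {c} i ii ag)))) , refl)
sweep-spec (when e c) {s} {s′} (ie , sw) ag p q with eval s e in eq
... | zero  = inj₂ ((λ x (nz , _) → nz (trans (sym (eval-agree {c} e ie ag)) eq)) , refl)
... | suc k with sweep-spec c sw ag p q
...   | inj₁ h = inj₁ ((λ z → contradiction (trans (sym eq) (trans (eval-agree {c} e ie ag) z)) λ ()) , h)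
...   | inj₂ (¬h , same) = inj₂ ((λ x (_ , h) → ¬h x h) , same)
sweep-spec (for v i c) {s} {s′} (v≢0 , fr0 , v≢t , sw) ag p q
  with go (s 0 i 0) (update s v 0 0 (s 0 i 0))
          (λ {b} {p} {q} eq → trans (update-other-cell s v (∨-conicalˡ ((v ≡ᵇ b) ∧ (0 ≡ᵇ p) ∧ (0 ≡ᵇ q)) _ eq)) (ag eq))
  where
  t = target c

  go : ∀ k r → Agree (for v i c) r s′ →
       (∃[ j ] (j < k × Hit c (update s′ v 0 0 j) p q (countdown (exec c) v k r t p q))) ⊎
       ((∀ j x → j < k → ¬ Hit c (update s′ v 0 0 j) p q x) × countdown (exec c) v k r t p q ≡ r t p q)
  go zero    r ag = inj₂ ((λ j x ()) , refl)
  go (suc k) r ag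
    with go k (exec c (update r v 0 0 k)) (λ {b} {p} {q} eq →
           trans (frame c _ (∨-conicalʳ ((v ≡ᵇ b) ∧ (0 ≡ᵇ p) ∧ (0 ≡ᵇ q)) _ eq))
                 (trans (update-other-cell r v (∨-conicalˡ ((v ≡ᵇ b) ∧ (0 ≡ᵇ p) ∧ (0 ≡ᵇ q)) _ eq)) (ag eq)))
       | sweep-spec c {update r v 0 0 k} {update s′ v 0 0 k} sw (update-agree {v} {i} {c} k ag) p q
  ... | inj₁ (j , j<k , h) | _ = inj₁ (j , m≤n⇒m≤1+n j<k , h)
  ... | inj₂ (¬h , same) | inj₁ h = inj₁ (k , ≤-refl , subst (Hit c _ p q) (sym same) h)
  ... | inj₂ (¬h , same) | inj₂ (¬h′ , same′) = inj₂ (none ,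
        trans same (trans same′ (update-other-array r v 0 0 p q (T-not⇒≡false v≢t))))
    where
    none : ∀ j x → j < suc k → ¬ Hit c (update s′ v 0 0 j) p q x
    none j x (s≤s j≤k) h with m≤n⇒m<n∨m≡n j≤k
    ... | inj₁ j<k  = ¬h j x j<k h
    ... | inj₂ refl = ¬h′ x h
... | inj₁ (j , j<k , h) = inj₁ (j , subst (j <_) 0i j<k , h)
  where
  0i : s 0 i 0 ≡ s′ 0 i 0
  0i = ag (fresh⇒untouched (for v i c) (v≢0 , fr0) i 0)
... | inj₂ (¬h , same) = inj₂ ((λ x (j , j<k , h) → ¬h j x (subst (j <_) (sym 0i) j<k) h) ,
        trans same (update-other-array s v 0 0 p q (T-not⇒≡false v≢t)))
  where
  0i : s 0 i 0 ≡ s′ 0 i 0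
  0i = ag (fresh⇒untouched (for v i c) (v≢0 , fr0) i 0)

-- Counting in lists and decoding the input

module _ {A : Set} {P Q : Pred A 0ℓ} (P? : Decidable P) (Q? : Decidable Q)
         (P⇒Q : ∀ {x} → P x → Q x) where

  length-filter-mono : ∀ xs → length (filter P? xs) ≤ length (filter Q? xs)
  length-filter-mono [] = z≤n
  length-filter-mono (x ∷ xs) with P? x | Q? x
  ... | yes p | yes _ = s≤s (length-filter-mono xs)
  ... | yes p | no ¬q = contradiction (P⇒Q p) ¬q
  ... | no _  | yes _ = m≤n⇒m≤1+n (length-filter-mono xs)
  ... | no _  | no _  = length-filter-mono xs

  length-filter-strict : ∀ {x xs} → x ∈ˡ xs → Q x → ¬ P x →
                         length (filter P? xs) < length (filter Q? xs)
  length-filter-strict {x} {_ ∷ xs} (here refl) q ¬p with P? x | Q? x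
  ... | yes p | _     = contradiction p ¬p
  ... | no _  | yes _ = s≤s (length-filter-mono xs)
  ... | no _  | no ¬q = contradiction q ¬q
  length-filter-strict {xs = y ∷ xs} (there x∈) q ¬p with P? y | Q? y
  ... | yes p | yes _ = s≤s (length-filter-strict x∈ q ¬p)
  ... | yes p | no ¬q = contradiction (P⇒Q p) ¬q
  ... | no _  | yes _ = m≤n⇒m≤1+n (length-filter-strict x∈ q ¬p)
  ... | no _  | no _  = length-filter-strict x∈ q ¬p

length-cartesianProduct : ∀ {A B : Set} (xs : List A) (ys : List B) →
                          length (cartesianProduct xs ys) ≡ length xs * length ys
length-cartesianProduct []       ys = refl
length-cartesianProduct (x ∷ xs) ys =
  trans (length-++ (map (x ,_) ys))
        (cong₂ _+_ (length-map (x ,_) ys) (length-cartesianProduct xs ys))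

-- The tail of `allFin` is tabulated by `suc`, so the induction needs a general `f` in place of the
-- identity.
length-filter-tabulate : ∀ {n k} (V : Subset k) (U : Subset n) (f : Fin n → Fin k) →
                         (∀ i → f i ∈ V ⇔ i ∈ U) → length (filter (_∈? V) (tabulateˡ f)) ≡ ∣ U ∣
length-filter-tabulate V []      f eqv = refl
length-filter-tabulate V (x ∷ U) f eqv = head x eqv (length-filter-tabulate V U (f ∘ suc) λ i →
    mk⇔ (drop-there ∘ Equivalence.to (eqv (suc i))) (Equivalence.from (eqv (suc i)) ∘ there))
  where
  head : ∀ x → (∀ i → f i ∈ V ⇔ i ∈ x ∷ U) → length (filter (_∈? V) (tabulateˡ (f ∘ suc))) ≡ ∣ U ∣ →
         length (filter (_∈? V) (tabulateˡ f)) ≡ ∣ x ∷ U ∣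
  head x eqv ih with f zero ∈? V
  head inside  eqv ih | yes _  = cong suc ih
  head outside eqv ih | yes f₀ = contradiction (Equivalence.to (eqv zero) f₀) λ ()
  head inside  eqv ih | no ¬f₀ = contradiction (Equivalence.from (eqv zero) here) ¬f₀
  head outside eqv ih | no _   = ih

length-members : ∀ {n} (U : Subset n) → length (members U) ≡ ∣ U ∣
length-members U = length-filter-tabulate U U id λ _ → mk⇔ id id

∈-members⁺ : ∀ {n} {U : Subset n} {u} → u ∈ U → u ∈ˡ members U
∈-members⁺ {U = U} = ∈-filter⁺ (_∈? U) (∈-allFin _)

∈-members⁻ : ∀ {n} {U : Subset n} {u} → u ∈ˡ members U → u ∈ U
∈-members⁻ {n} {U} = proj₂ ∘ ∈-filter⁻ (_∈? U) {xs = allFin n}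

at⁻ : ∀ {n} (xs : List (Fin n)) i → i < length xs → ∃[ x ] (x ∈ˡ xs × at (map toℕ xs) i ≡ toℕ x)
at⁻ (x ∷ xs) zero    _ = x , here refl , refl
at⁻ (x ∷ xs) (suc i) (s≤s i<) with y , y∈ , eq ← at⁻ xs i i< = y , there y∈ , eq

at⁺ : ∀ {n} {xs : List (Fin n)} {x} → x ∈ˡ xs → ∃[ i ] (i < length xs × at (map toℕ xs) i ≡ toℕ x)
at⁺ (here refl) = 0 , s≤s z≤n , refl
at⁺ (there x∈) with i , i< , eq ← at⁺ x∈ = suc i , s≤s i< , eq

table-inside : ∀ {n m} {U : Subset n} {W : Subset m} (f : Fin n → Fin m → ℕ) {u w} →
               u ∈ U → w ∈ W → table U W f (toℕ u) (toℕ w) ≡ f u w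
table-inside {n} {m} {U} {W} f {u} {w} u∈ w∈ with toℕ u <? n | toℕ w <? m
... | no ¬p | _     = contradiction (toℕ<n u) ¬p
... | yes p | no ¬q = contradiction (toℕ<n w) ¬q
... | yes p | yes q with fromℕ< p ∈? U | fromℕ< q ∈? W
...   | yes _  | yes _  = cong₂ f (fromℕ<-toℕ u p) (fromℕ<-toℕ w q)
...   | yes _  | no w∉  = contradiction (subst (_∈ W) (sym (fromℕ<-toℕ w q)) w∈) w∉
...   | no  u∉ | _      = contradiction (subst (_∈ U) (sym (fromℕ<-toℕ u p)) u∈) u∉

module _ {n m} (P : Preferences n m) {W : Subset m} {u : Fin n} where
  open Preferences P
  private module O = IsStrictTotalOrder (manOrder u)

  -- Strict because `w` is counted in the rank of `w′` but not in her own.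
  rank-mono : ∀ {w w′} → w ∈ W → ManPrefers u w w′ → manRank P W u w < manRank P W u w′
  rank-mono w∈ p = length-filter-strict (λ x → x O.<? _) (λ x → x O.<? _) (λ q → O.trans q p)
                     (∈-members⁺ w∈) p (O.irrefl refl)

  rank-cancel : ∀ {w w′} → w′ ∈ W → manRank P W u w < manRank P W u w′ → ManPrefers u w w′
  rank-cancel {w} {w′} w′∈ lt with O.compare w w′
  ... | tri< p _ _    = p
  ... | tri≈ _ refl _ = contradiction lt (<-irrefl refl)
  ... | tri> _ _ p    = contradiction lt (<-asym (rank-mono w′∈ p))

-- The programs

data Side : Set where
  men women : Side

other : Side → Side
other men   = women
other women = men

man woman : ℕ → Expr
man   v = cell 1 (var v) (lit 0)
woman v = cell 2 (var v) (lit 0)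

-- scan σ g t x assigns x to the cell (u , w) of t if one of the two persons has on side σ
-- a preferred partner such that g is nonzero for the pair.
scan : Side → (Expr → Expr → Expr) → ℕ → ℕ → Stmt
scan women g t x = for 8 0 (for 9 1 (for 10 1
  (when (cell 3 (man 8) (woman 9) ⊖ cell 3 (man 8) (woman 10))
  (when (g (man 8) (woman 10))
  (set t (man 8) (woman 9) (lit x))))))
scan men g t x = for 8 0 (for 9 1 (for 10 0
  (when (cell 4 (man 8) (woman 9) ⊖ cell 4 (man 10) (woman 9))
  (when (g (man 10) (woman 9))
  (set t (man 8) (woman 9) (lit x))))))

notRejected : Expr → Expr → Expr
notRejected e f = lit 1 ⊖ cell 7 e f

-- Makes every unrejected pair a candidate; the scan in `propose` then erases those whose proposer
-- has a better unrejected partner.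
reset : Stmt
reset = for 8 0 (for 9 1 (set 6 (man 8) (woman 9) (notRejected (man 8) (woman 9))))

-- Array 7 marks the rejected pairs and array 6 the proposals; σ is the receiving side.
propose reject round main : Side → Stmt
propose σ = reset ▸ scan σ notRejected 6 0
reject σ  = scan (other σ) (cell 6) 7 1
round σ   = propose σ ▸ reject σ
-- The two loops give as many rounds as there are pairs, which suffices as each round before the
-- fixed point rejects a new one. The final `propose` is needed because array 6 still shows the
-- proposals made before the last rejections.
main σ    = for 11 0 (for 12 1 (round σ)) ▸ propose σ

-- The second stage knows `M₁*` only through the weights in array 5. Its initial scan rejects on
-- behalf of each man all women he likes less than a partner of nonzero weight; then the men are the
-- receiving side.
stage₁ stage₂ : Stmt
stage₁ = main women
stage₂ = scan women (cell 5) 7 1 ▸ main men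

-- Meaning of the programs on an encoded market

module Market {n m} (P : Preferences n m) (U : Subset n) (W : Subset m)
              (ω : Fin n → Fin m → ℕ) where
  open Preferences P
  private
    module Men   = DeferredAcceptance P U W
    module Women = DeferredAcceptance (dual P) W U

  input : Store
  input = inputStore P U W ω

  Intact : ℕ → Store → Set
  Intact b s = ∀ p q → s b p q ≡ input b p q

  Loaded : Store → Set
  Loaded s = Intact 0 s × Intact 1 s × Intact 2 s × Intact 3 s × Intact 4 s × Intact 5 s

  FreshInput : Stmt → Set
  FreshInput c = Fresh 0 c × Fresh 1 c × Fresh 2 c × Fresh 3 c × Fresh 4 c × Fresh 5 c

  loaded-exec : ∀ c {s} → FreshInput c → Loaded s → Loaded (exec c s)
  loaded-exec c {s} (f₀ , f₁ , f₂ , f₃ , f₄ , f₅) (l₀ , l₁ , l₂ , l₃ , l₄ , l₅) =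
    keep f₀ l₀ , keep f₁ l₁ , keep f₂ l₂ , keep f₃ l₃ , keep f₄ l₄ , keep f₅ l₅
    where
    keep : ∀ {b} → Fresh b c → Intact b s → Intact b (exec c s)
    keep fr l p q = trans (frame c s (fresh⇒untouched c fr p q)) (l p q)

  module _ {s : Store} (loaded : Loaded s) where
    private
      l₀ = proj₁ loaded
      l₁ = proj₁ (proj₂ loaded)
      l₂ = proj₁ (proj₂ (proj₂ loaded))
      l₃ = proj₁ (proj₂ (proj₂ (proj₂ loaded)))
      l₄ = proj₁ (proj₂ (proj₂ (proj₂ (proj₂ loaded))))

    man⁻ : ∀ {i} → i < s 0 0 0 → ∃[ u ] (u ∈ U × s 1 i 0 ≡ toℕ u)
    man⁻ {i} i< with u , u∈ , eq ← at⁻ (members U) i (subst (i <_) (l₀ 0 0) i<) =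
      u , ∈-members⁻ u∈ , trans (l₁ i 0) eq

    man⁺ : ∀ {u} → u ∈ U → ∃[ i ] (i < s 0 0 0 × s 1 i 0 ≡ toℕ u)
    man⁺ u∈ with i , i< , eq ← at⁺ (∈-members⁺ u∈) =
      i , subst (i <_) (sym (l₀ 0 0)) i< , trans (l₁ i 0) eq

    woman⁻ : ∀ {j} → j < s 0 1 0 → ∃[ w ] (w ∈ W × s 2 j 0 ≡ toℕ w)
    woman⁻ {j} j< with w , w∈ , eq ← at⁻ (members W) j (subst (j <_) (l₀ 1 0) j<) =
      w , ∈-members⁻ w∈ , trans (l₂ j 0) eq

    woman⁺ : ∀ {w} → w ∈ W → ∃[ j ] (j < s 0 1 0 × s 2 j 0 ≡ toℕ w)
    woman⁺ w∈ with j , j< , eq ← at⁺ (∈-members⁺ w∈) =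
      j , subst (j <_) (sym (l₀ 1 0)) j< , trans (l₂ j 0) eq

    manRank-cell : ∀ {u w} → u ∈ U → w ∈ W → s 3 (toℕ u) (toℕ w) ≡ manRank P W u w
    manRank-cell u∈ w∈ = trans (l₃ _ _) (table-inside (manRank P W) u∈ w∈)

    womanRank-cell : ∀ {u w} → u ∈ U → w ∈ W → s 4 (toℕ u) (toℕ w) ≡ womanRank P U u w
    womanRank-cell u∈ w∈ = trans (l₄ _ _) (table-inside (womanRank P U) u∈ w∈)

    manPrefers⇔ : ∀ {u w w′} → u ∈ U → w ∈ W → w′ ∈ W →
                  s 3 (toℕ u) (toℕ w) ∸ s 3 (toℕ u) (toℕ w′) ≢ 0 ⇔ ManPrefers u w′ w
    manPrefers⇔ u∈ w∈ w′∈ rewrite manRank-cell u∈ w∈ | manRank-cell u∈ w′∈ =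
      mk⇔ (rank-cancel P w∈ ∘ m∸n≢0⇒n<m) (m>n⇒m∸n≢0 ∘ rank-mono P w′∈)

    womanPrefers⇔ : ∀ {u u′ w} → u ∈ U → u′ ∈ U → w ∈ W →
                    s 4 (toℕ u) (toℕ w) ∸ s 4 (toℕ u′) (toℕ w) ≢ 0 ⇔ WomanPrefers w u′ u
    womanPrefers⇔ u∈ u′∈ w∈ rewrite womanRank-cell u∈ w∈ | womanRank-cell u′∈ w∈ =
      mk⇔ (rank-cancel (dual P) u∈ ∘ m∸n≢0⇒n<m) (m>n⇒m∸n≢0 ∘ rank-mono (dual P) u′∈)

  Dominated : Side → PairRel n m → PairRel n m
  Dominated women C u w = ∃[ w′ ] (w′ ∈ W × ManPrefers u w′ w × C u w′)
  Dominated men   C u w = ∃[ u′ ] (u′ ∈ U × WomanPrefers w u′ u × C u′ w)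

  dominated-map : ∀ σ {C C′ : PairRel n m} → (∀ {u w} → C u w → C′ u w) →
                  ∀ {u w} → Dominated σ C u w → Dominated σ C′ u w
  dominated-map women f (w′ , w′∈ , p , c) = w′ , w′∈ , p , f c
  dominated-map men   f (u′ , u′∈ , p , c) = u′ , u′∈ , p , f c

  -- The value of Hit (scan σ g t x), where G is the meaning of g.
  ScanHit : Side → Store → (ℕ → ℕ → ℕ) → ℕ → ℕ → ℕ → ℕ → Set
  ScanHit women s G x p q v =
    ∃[ i ] (i < s 0 0 0 × ∃[ j ] (j < s 0 1 0 × ∃[ k ] (k < s 0 1 0 ×
      s 3 (s 1 i 0) (s 2 j 0) ∸ s 3 (s 1 i 0) (s 2 k 0) ≢ 0 ×
      G (s 1 i 0) (s 2 k 0) ≢ 0 × p ≡ s 1 i 0 × q ≡ s 2 j 0 × v ≡ x)))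
  ScanHit men s G x p q v =
    ∃[ i ] (i < s 0 0 0 × ∃[ j ] (j < s 0 1 0 × ∃[ k ] (k < s 0 0 0 ×
      s 4 (s 1 i 0) (s 2 j 0) ∸ s 4 (s 1 k 0) (s 2 j 0) ≢ 0 ×
      G (s 1 k 0) (s 2 j 0) ≢ 0 × p ≡ s 1 i 0 × q ≡ s 2 j 0 × v ≡ x)))

  Gated : (ℕ → ℕ → ℕ) → PairRel n m
  Gated G u w = G (toℕ u) (toℕ w) ≢ 0

  Marks : Side → PairRel n m → PairRel n m
  Marks σ C u w = u ∈ U × w ∈ W × Dominated σ C u w

  scanHit⁻ : ∀ σ {s G x u w v} → Loaded s → ScanHit σ s G x (toℕ u) (toℕ w) v →
             Marks σ (Gated G) u w × v ≡ x
  scanHit⁻ women {s} ld (i , i< , j , j< , k , k< , r , g , p , q , eq)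
    with s 1 i 0 | man⁻ {s} ld i< | s 2 j 0 | woman⁻ {s} ld j< | s 2 k 0 | woman⁻ {s} ld k<
  ... | _ | u′ , u∈ , refl | _ | w′ , w∈ , refl | _ | w″ , w″∈ , refl
    with refl ← toℕ-injective p | refl ← toℕ-injective q =
    (u∈ , w∈ , w″ , w″∈ , Equivalence.to (manPrefers⇔ {s} ld u∈ w∈ w″∈) r , g) , eq
  scanHit⁻ men {s} ld (i , i< , j , j< , k , k< , r , g , p , q , eq)
    with s 1 i 0 | man⁻ {s} ld i< | s 2 j 0 | woman⁻ {s} ld j< | s 1 k 0 | man⁻ {s} ld k<
  ... | _ | u′ , u∈ , refl | _ | w′ , w∈ , refl | _ | u″ , u″∈ , refl
    with refl ← toℕ-injective p | refl ← toℕ-injective q =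
    (u∈ , w∈ , u″ , u″∈ , Equivalence.to (womanPrefers⇔ {s} ld u∈ u″∈ w∈) r , g) , eq

  scanHit⁺ : ∀ σ {s G x u w} → Loaded s → Marks σ (Gated G) u w →
             ScanHit σ s G x (toℕ u) (toℕ w) x
  scanHit⁺ women {s} {G} ld (u∈ , w∈ , w′ , w′∈ , p , g)
    with i , i< , eᵢ ← man⁺ {s} ld u∈ | j , j< , eⱼ ← woman⁺ {s} ld w∈ | k , k< , eₖ ← woman⁺ {s} ld w′∈ =
    i , i< , j , j< , k , k< ,
    subst₂ (λ a b → s 3 a b ∸ s 3 a (s 2 k 0) ≢ 0) (sym eᵢ) (sym eⱼ)
      (subst (λ c → s 3 _ _ ∸ s 3 _ c ≢ 0) (sym eₖ) (Equivalence.from (manPrefers⇔ {s} ld u∈ w∈ w′∈) p)) ,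
    subst₂ (λ a b → G a b ≢ 0) (sym eᵢ) (sym eₖ) g , sym eᵢ , sym eⱼ , refl
  scanHit⁺ men {s} {G} ld (u∈ , w∈ , u′ , u′∈ , p , g)
    with i , i< , eᵢ ← man⁺ {s} ld u∈ | j , j< , eⱼ ← woman⁺ {s} ld w∈ | k , k< , eₖ ← man⁺ {s} ld u′∈ =
    i , i< , j , j< , k , k< ,
    subst₂ (λ a b → s 4 a b ∸ s 4 (s 1 k 0) b ≢ 0) (sym eᵢ) (sym eⱼ)
      (subst (λ c → s 4 _ _ ∸ s 4 c _ ≢ 0) (sym eₖ) (Equivalence.from (womanPrefers⇔ {s} ld u∈ u′∈ w∈) p)) ,
    subst₂ (λ a b → G a b ≢ 0) (sym eₖ) (sym eⱼ) g , sym eᵢ , sym eⱼ , refl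

  Marked : Side → PairRel n m → ℕ → ℕ → Store → Store → Set
  Marked σ C t x s s′ = ∀ u w →
    (Marks σ C u w × s′ t (toℕ u) (toℕ w) ≡ x) ⊎
    (¬ Marks σ C u w × s′ t (toℕ u) (toℕ w) ≡ s t (toℕ u) (toℕ w))

  abstract
    -- `Hit` computes to `ScanHit` only when the side and the gate are concrete. The specification
    -- is therefore an argument, and each scan is instantiated separately.
    marked : ∀ σ c {s G t x} → Loaded s →
             (∀ p q → ScanHit σ s G x p q (exec c s t p q) ⊎
                      ((∀ v → ¬ ScanHit σ s G x p q v) × exec c s t p q ≡ s t p q)) →
             Marked σ (Gated G) t x s (exec c s)
    marked σ c {s} {G} {x = x} ld spec u w with spec (toℕ u) (toℕ w)
    ... | inj₁ h = inj₁ (scanHit⁻ σ {s} {G} {x} ld h)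
    ... | inj₂ (¬h , same) = inj₂ ((λ d → ¬h x (scanHit⁺ σ {s} {G} {x} ld d)) , same)

    scan-notRejected : ∀ σ {s} → Loaded s →
      Marked σ (Gated λ p q → 1 ∸ s 7 p q) 6 0 s (exec (scan σ notRejected 6 0) s)
    scan-notRejected women {s} ld = marked women (scan women notRejected 6 0) {s} {λ p q → 1 ∸ s 7 p q} ld
      (sweep-spec (scan women notRejected 6 0) {s} {s} _ λ _ → refl)
    scan-notRejected men {s} ld = marked men (scan men notRejected 6 0) {s} {λ p q → 1 ∸ s 7 p q} ld
      (sweep-spec (scan men notRejected 6 0) {s} {s} _ λ _ → refl)

    scan-proposals : ∀ σ {s} → Loaded s →
      Marked σ (Gated (s 6)) 7 1 s (exec (scan σ (cell 6) 7 1) s)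
    scan-proposals women {s} ld = marked women (scan women (cell 6) 7 1) {s} {s 6} ld
      (sweep-spec (scan women (cell 6) 7 1) {s} {s} _ λ _ → refl)
    scan-proposals men {s} ld = marked men (scan men (cell 6) 7 1) {s} {s 6} ld
      (sweep-spec (scan men (cell 6) 7 1) {s} {s} _ λ _ → refl)

    scan-weights : ∀ {s} → Loaded s →
      Marked women (Gated (s 5)) 7 1 s (exec (scan women (cell 5) 7 1) s)
    scan-weights {s} ld = marked women (scan women (cell 5) 7 1) {s} {s 5} ld
      (sweep-spec (scan women (cell 5) 7 1) {s} {s} _ λ _ → refl)

    reset-spec : ∀ {s} → Loaded s → ∀ u w →
      (u ∈ U × w ∈ W × exec reset s 6 (toℕ u) (toℕ w) ≡ 1 ∸ s 7 (toℕ u) (toℕ w)) ⊎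
      (¬ (u ∈ U × w ∈ W) × exec reset s 6 (toℕ u) (toℕ w) ≡ s 6 (toℕ u) (toℕ w))
    reset-spec {s} ld u w with sweep-spec reset {s} {s} _ (λ _ → refl) (toℕ u) (toℕ w)
    ... | inj₁ (i , i< , j , j< , p , q , eq)
      with u′ , u′∈ , eᵢ ← man⁻ {s} ld i< | w′ , w′∈ , eⱼ ← woman⁻ {s} ld j<
      with refl ← toℕ-injective (trans p eᵢ) | refl ← toℕ-injective (trans q eⱼ) =
      inj₁ (u′∈ , w′∈ , trans eq (cong₂ (λ a b → 1 ∸ s 7 a b) eᵢ eⱼ))
    ... | inj₂ (¬h , same) = inj₂ ((λ (u∈ , w∈) → hit (man⁺ {s} ld u∈) (woman⁺ {s} ld w∈)) , same)
      where
      hit : ∃[ i ] (i < s 0 0 0 × s 1 i 0 ≡ toℕ u) → ¬ (∃[ j ] (j < s 0 1 0 × s 2 j 0 ≡ toℕ w))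
      hit (i , i< , eᵢ) (j , j< , eⱼ) = ¬h _ (i , i< , j , j< , sym eᵢ , sym eⱼ , refl)

  Rejected : Store → PairRel n m
  Rejected s u w = s 7 (toℕ u) (toℕ w) ≢ 0

  rejected? : ∀ s u w → Dec (Rejected s u w)
  rejected? s u w = ¬? (s 7 (toℕ u) (toℕ w) ≟ 0)

  Proposes Step : Side → PairRel n m → PairRel n m
  Proposes women R u w = Men.Proposes R u w
  Proposes men   R u w = Women.Proposes (flip R) w u
  Step women R u w = Men.Step R u w
  Step men   R u w = Women.Step (flip R) w u

  Fixed : Side → PairRel n m → Set
  Fixed women R = Men.Fixed R
  Fixed men   R = Women.Fixed (flip R)

  proposes⇔ : ∀ σ {R u w} → Proposes σ R u w ⇔
              (u ∈ U × w ∈ W × ¬ R u w × ¬ Dominated σ (λ u w → ¬ R u w) u w)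
  proposes⇔ women = mk⇔ (λ p → p) (λ p → p)
  proposes⇔ men   = mk⇔ (λ (w∈ , u∈ , p) → u∈ , w∈ , p) (λ (u∈ , w∈ , p) → w∈ , u∈ , p)

  step⇔ : ∀ σ {R u w} → Step σ R u w ⇔ (R u w ⊎ Marks (other σ) (Proposes σ R) u w)
  step⇔ women = mk⇔ (λ p → p) (λ p → p)
  step⇔ men   = mk⇔ [ inj₁ , (λ (w∈ , u∈ , p) → inj₂ (u∈ , w∈ , p)) ]
                    [ inj₁ , (λ (u∈ , w∈ , p) → inj₂ (w∈ , u∈ , p)) ]

  fixed⁺ : ∀ σ {R} → (∀ {u w} → Marks (other σ) (Proposes σ R) u w → R u w) → Fixed σ R
  fixed⁺ women fix u∈ w∈ o = fix (u∈ , w∈ , o)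
  fixed⁺ men   fix w∈ u∈ o = fix (u∈ , w∈ , o)

  fixed-step : ∀ σ {R R′} → (∀ u w → R′ u w ⇔ Step σ R u w) → Fixed σ R → Fixed σ R′
  fixed-step women eqv = Men.fixed-step eqv
  fixed-step men   eqv = Women.fixed-step λ w u → eqv u w

  -- `Outputs` inspects all pairs, whereas `reset` and the scans write only on `U` times `W`; the
  -- remaining cells must be 0 throughout.
  Blank : Store → Set
  Blank s = ∀ u w → ¬ (u ∈ U × w ∈ W) → s 6 (toℕ u) (toℕ w) ≡ 0

  Displays : Store → PairRel n m → Set
  Displays s Q = ∀ u w → (Q u w × s 6 (toℕ u) (toℕ w) ≡ 1) ⊎ (¬ Q u w × s 6 (toℕ u) (toℕ w) ≡ 0)

  private
    1∸≢0⇒≡0 : ∀ {k} → 1 ∸ k ≢ 0 → k ≡ 0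
    1∸≢0⇒≡0 {zero}  _  = refl
    1∸≢0⇒≡0 {suc k} nz = contradiction (0∸n≡0 k) nz

    ≢0⇒1∸≡0 : ∀ {k} → k ≢ 0 → 1 ∸ k ≡ 0
    ≢0⇒1∸≡0 {zero}  nz = contradiction refl nz
    ≢0⇒1∸≡0 {suc k} _  = 0∸n≡0 k

  fresh-propose : ∀ σ → FreshInput (propose σ) × Fresh 7 (propose σ)
  fresh-propose women = _
  fresh-propose men   = _

  fresh-reject : ∀ σ → FreshInput (reject σ) × Fresh 6 (reject σ)
  fresh-reject women = _
  fresh-reject men   = _

  abstract
    propose-spec : ∀ σ {s} → Loaded s → Blank s → Displays (exec (propose σ) s) (Proposes σ (Rejected s))
    propose-spec σ {s} ld blank u w
      with scan-notRejected σ {exec reset s} (loaded-exec reset {s} _ ld) u w | reset-spec {s} ld u w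
    ... | inj₁ ((u∈ , w∈ , dom) , zeroed) | _ =
      inj₂ ((λ pr → proj₂ (proj₂ (proj₂ (Equivalence.to (proposes⇔ σ) pr))) (dominated-map σ open⁻ dom)) , zeroed)
      where
      open⁻ : ∀ {u w} → 1 ∸ exec reset s 7 (toℕ u) (toℕ w) ≢ 0 → ¬ Rejected s u w
      open⁻ nz r = r (1∸≢0⇒≡0 (subst (λ k → 1 ∸ k ≢ 0) (frame reset s refl) nz))
    ... | inj₂ (¬dom , same) | inj₂ (∉ , same′) =
      inj₂ ((λ pr → let u∈ , w∈ , _ = Equivalence.to (proposes⇔ σ) pr in ∉ (u∈ , w∈)) ,
            trans same (trans same′ (blank u w ∉)))
    ... | inj₂ (¬dom , same) | inj₁ (u∈ , w∈ , val) with rejected? s u w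
    ...   | yes r = inj₂ ((λ pr → proj₁ (proj₂ (proj₂ (Equivalence.to (proposes⇔ σ) pr))) r) ,
                          trans same (trans val (≢0⇒1∸≡0 r)))
    ...   | no ¬r = inj₁ (Equivalence.from (proposes⇔ σ)
                            (u∈ , w∈ , ¬r , λ dom → ¬dom (u∈ , w∈ , dominated-map σ open⁺ dom)) ,
                          trans same (trans val (cong (1 ∸_) (decidable-stable (_ ≟ 0) ¬r))))
      where
      open⁺ : ∀ {u w} → ¬ Rejected s u w → 1 ∸ exec reset s 7 (toℕ u) (toℕ w) ≢ 0
      open⁺ {u} {w} ¬r′ eq = contradiction
        (subst (λ k → 1 ∸ k ≡ 0) (trans (frame reset s refl) (decidable-stable (_ ≟ 0) ¬r′)) eq) λ ()

    displays-blank : ∀ σ {s R} → Displays s (Proposes σ R) → Blank s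
    displays-blank σ disp u w ∉ with disp u w
    ... | inj₁ (pr , _) = let u∈ , w∈ , _ = Equivalence.to (proposes⇔ σ) pr in contradiction (u∈ , w∈) ∉
    ... | inj₂ (_ , z)  = z

    round-spec : ∀ σ {s} → Loaded s → Blank s →
                 Loaded (exec (round σ) s) × Blank (exec (round σ) s) ×
                 (∀ u w → Rejected (exec (round σ) s) u w ⇔ Step σ (Rejected s) u w)
    round-spec σ {s} ld blank =
      loaded-exec (reject σ) {s₁} (proj₁ (fresh-reject σ)) ld₁ ,
      (λ u w ∉ → trans (frame (reject σ) s₁ (fresh⇒untouched (reject σ) (proj₂ (fresh-reject σ)) _ _))
                       (displays-blank σ {s₁} disp u w ∉)) ,
      λ u w → mk⇔ (Equivalence.from (step⇔ σ) ∘ new⁻ u w) (new⁺ u w ∘ Equivalence.to (step⇔ σ))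
      where
      s₁ : Store
      s₁ = exec (propose σ) s

      ld₁ : Loaded s₁
      ld₁ = loaded-exec (propose σ) {s} (proj₁ (fresh-propose σ)) ld

      disp : Displays s₁ (Proposes σ (Rejected s))
      disp = propose-spec σ {s} ld blank

      same₇ : ∀ p q → s₁ 7 p q ≡ s 7 p q
      same₇ p q = frame (propose σ) s (fresh⇒untouched (propose σ) (proj₂ (fresh-propose σ)) p q)

      shown⁻ : ∀ {u w} → s₁ 6 (toℕ u) (toℕ w) ≢ 0 → Proposes σ (Rejected s) u w
      shown⁻ {u} {w} nz with disp u w
      ... | inj₁ (pr , _) = pr
      ... | inj₂ (_ , z)  = contradiction z nz

      shown⁺ : ∀ {u w} → Proposes σ (Rejected s) u w → s₁ 6 (toℕ u) (toℕ w) ≢ 0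
      shown⁺ {u} {w} pr z with disp u w
      ... | inj₁ (_ , eq)  = contradiction (trans (sym eq) z) λ ()
      ... | inj₂ (¬pr , _) = ¬pr pr

      new⁻ : ∀ u w → Rejected (exec (round σ) s) u w →
             Rejected s u w ⊎ Marks (other σ) (Proposes σ (Rejected s)) u w
      new⁻ u w nz with scan-proposals (other σ) {s₁} ld₁ u w
      ... | inj₁ ((u∈ , w∈ , dom) , _) = inj₂ (u∈ , w∈ , dominated-map (other σ) shown⁻ dom)
      ... | inj₂ (_ , same) = inj₁ λ z → nz (trans same (trans (same₇ _ _) z))

      new⁺ : ∀ u w → Rejected s u w ⊎ Marks (other σ) (Proposes σ (Rejected s)) u w →
             Rejected (exec (round σ) s) u w
      new⁺ u w e z with scan-proposals (other σ) {s₁} ld₁ u w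
      ... | inj₁ (_ , one) = contradiction (trans (sym one) z) λ ()
      ... | inj₂ (¬dom , same) =
        [ (λ r → r (trans (sym (same₇ _ _)) (trans (sym same) z))) ,
          (λ (u∈ , w∈ , dom) → ¬dom (u∈ , w∈ , dominated-map (other σ) shown⁺ dom)) ] e

  -- Unless a fixed point has been reached, each round rejects a new pair.

  size² : ℕ
  size² = length (members U) * length (members W)

  rejections : Store → ℕ
  rejections s = length (filter (λ (u , w) → rejected? s u w) (cartesianProduct (members U) (members W)))

  ∈-pairs : ∀ {u w} → u ∈ U → w ∈ W → (u , w) ∈ˡ cartesianProduct (members U) (members W)
  ∈-pairs u∈ w∈ = ∈-cartesianProduct⁺ (∈-members⁺ u∈) (∈-members⁺ w∈)

  -- `k` is both the number of rounds to go and a bound on the number of pairs not yet rejected.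
  Progress : Side → ℕ → Store → Set
  Progress σ k s = Fixed σ (Rejected s) ⊎ size² ≤ rejections s + k

  progress-end : ∀ σ {s} → Progress σ 0 s → Fixed σ (Rejected s)
  progress-end σ (inj₁ fix) = fix
  progress-end σ {s} (inj₂ full) = fixed⁺ σ λ {u} {w} (u∈ , w∈ , _) →
    decidable-stable (rejected? s u w) λ ¬r → <⇒≱
      (subst (rejections s <_) (length-cartesianProduct (members U) (members W))
        (filter-notAll (λ (u , w) → rejected? s u w) _ (lose (∈-pairs u∈ w∈) ¬r)))
      (subst (size² ≤_) (+-identityʳ _) full)

  progress-step : ∀ σ {k s s′} → (∀ u w → Rejected s′ u w ⇔ Step σ (Rejected s) u w) →
                  Progress σ (suc k) s → Progress σ k s′
  progress-step σ eqv (inj₁ fix) = inj₁ (fixed-step σ eqv fix)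
  progress-step σ {k} {s} {s′} eqv (inj₂ le)
    with any? (λ u → any? λ w → rejected? s′ u w ×-dec ¬? (rejected? s u w))
  ... | no none = inj₁ (fixed-step σ eqv (fixed⁺ σ λ {u} {w} mk →
        decidable-stable (rejected? s u w) λ ¬r →
          none (u , w , Equivalence.from (eqv u w) (Equivalence.from (step⇔ σ) (inj₂ mk)) , ¬r)))
  ... | yes (u , w , r′ , ¬r) with Equivalence.to (step⇔ σ) (Equivalence.to (eqv u w) r′)
  ...   | inj₁ r = contradiction r ¬r
  ...   | inj₂ (u∈ , w∈ , _) = inj₂ (≤-trans le (subst (_≤ rejections s′ + k) (sym (+-suc (rejections s) k))
          (+-monoˡ-≤ k (length-filter-strict (λ (u , w) → rejected? s u w) (λ (u , w) → rejected? s′ u w)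
            (λ {(u , w)} r → Equivalence.from (eqv u w) (Equivalence.from (step⇔ σ) (inj₁ r)))
            (∈-pairs u∈ w∈) r′ ¬r))))

  module _ (σ : Side) (I : PairRel n m → Set₁)
           (I-step : ∀ {s s′} → (∀ u w → Rejected s′ u w ⇔ Step σ (Rejected s) u w) →
                     I (Rejected s) → I (Rejected s′)) where

    Running : ℕ → Store → Set₁
    Running k s = Loaded s × Blank s × I (Rejected s) × Progress σ k s

    abstract
      running-step : ∀ {k s} → Running (suc k) s → Running k (exec (round σ) s)
      running-step {k} {s} (ld , blank , i , pr) =
        let ld′ , blank′ , eqv = round-spec σ {s} ld blank
        in ld′ , blank′ , I-step {s} {exec (round σ) s} eqv i , progress-step σ {k} {s} {exec (round σ) s} eqv pr

      inner : ∀ k j s → Running (j + k) s → Running k (countdown (exec (round σ)) 12 j s)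
      inner k zero    s run = run
      -- `Running` inspects only arrays 0 to 7, so setting the loop counter preserves it by
      -- computation.
      inner k (suc j) s run = inner k j _ (running-step {j + k} {update s 12 0 0 j} run)

      outer : ∀ i s → Running (i * length (members W)) s →
              Running 0 (countdown (exec (for 12 1 (round σ))) 11 i s)
      outer zero    s run = run
      outer (suc i) s run@(ld , _) = outer i _ (inner (i * length (members W)) (s 0 1 0)
        (update (update s 11 0 0 i) 12 0 0 (s 0 1 0))
        (subst (λ j → Running (j + i * length (members W)) s) (sym (proj₁ ld 1 0)) run))

      -- `I` is left open: the first stage takes the invariant of deferred acceptance for `P`, the
      -- second the one for `dual P` at the transposed relation.
      main-spec : ∀ {s} → Loaded s → Blank s → I (Rejected s) →
                  ∃[ R ] (I R × Fixed σ R × Displays (exec (main σ) s) (Proposes σ R))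
      main-spec {s} ld blank i =
        let ld′ , blank′ , i′ , pr = run
        in Rejected s′ , i′ , progress-end σ {s′} pr , propose-spec σ {s′} ld′ blank′
        where
        s′ : Store
        s′ = exec (for 11 0 (for 12 1 (round σ))) s

        run : Running 0 s′
        run = outer (s 0 0 0) (update s 11 0 0 (s 0 0 0))
          (ld , blank , i , inj₂ (subst (λ a → size² ≤ rejections s + a * length (members W))
            (sym (proj₁ ld 0 0)) (m≤n+m size² (rejections s))))

-- Correctness and running time of the two stages

module _ {n m} (P : Preferences n m) (U : Subset n) (W : Subset m) (ω : Fin n → Fin m → ℕ) where
  open Market P U W ω

  input-small : ∀ i → input 0 i 0 ≤ 1 + ∣ U ∣ + ∣ W ∣
  input-small 0 = ≤-trans (≤-reflexive (length-members U)) (≤-trans (m≤m+n ∣ U ∣ ∣ W ∣) (n≤1+n _))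
  input-small 1 = ≤-trans (≤-reflexive (length-members W)) (≤-trans (m≤n+m ∣ W ∣ ∣ U ∣) (n≤1+n _))
  input-small (suc (suc i)) = z≤n

  displays-computes : ∀ c {k d} {Q : PairRel n m} → Fresh 0 c → Runnable c → factor c ≤ k → degree c ≤ d →
    (Q? : ∀ u w → Dec (Q u w)) → Displays (exec c input) Q →
    ComputesWithin (compile c) input (polyBound k d U W) (pairSet Q?)
  displays-computes c {Q = Q} fr ok k≤ d≤ Q? disp =
    let N = 1 + ∣ U ∣ + ∣ W ∣
        t , run , t≤ = compile-runs N c input fr ok input-small
    in exec c input , t , run , ≤-trans t≤ (*-mono-≤ k≤ (^-monoʳ-≤ N d≤)) , λ u w →
         mk⇔ (to u w ∘ Equivalence.to (∈-pairSet Q? u w)) (Equivalence.from (∈-pairSet Q? u w) ∘ from u w)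
    where
    to : ∀ u w → Q u w → exec c input 6 (toℕ u) (toℕ w) ≡ 1
    to u w q with disp u w
    ... | inj₁ (_ , one) = one
    ... | inj₂ (¬q , _)  = contradiction q ¬q

    from : ∀ u w → exec c input 6 (toℕ u) (toℕ w) ≡ 1 → Q u w
    from u w one with disp u w
    ... | inj₁ (q , _)  = q
    ... | inj₂ (_ , z) = contradiction (trans (sym z) one) λ ()

  stage₁-correct : ∀ {k d} → factor stage₁ ≤ k → degree stage₁ ≤ d →
    ∃[ M ] (ComputesWithin (compile stage₁) input (polyBound k d U W) M × IsMenOptimal P U W M)
  stage₁-correct k≤ d≤ = pairSet Q? , displays-computes stage₁ _ _ k≤ d≤ Q? (proj₂ (proj₂ (proj₂ final))) ,
    record
      -- Array 7 is zero in the input, so no pair is excluded from the outset.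
      { isStable = fromStable (outcome-stable inv fixed λ _ _ r → contradiction refl r) (∈-pairSet Q?)
      ; best = λ { u w (M , st , m) →
          let w′ , pr , ge = outcome-optimal inv fixed (toStable st) (λ r _ → r refl) m
          in w′ , Equivalence.from (∈-pairSet Q? u w′) pr , ge } }
    where
    open DeferredAcceptance P U W using (Invariant; invariant-start; invariant-step; proposes?; outcome-stable; outcome-optimal)

    final : ∃[ R ] (Invariant (Rejected input) R × Fixed women R × Displays (exec stage₁ input) (Proposes women R))
    final = main-spec women (Invariant (Rejected input))
      (λ {s} {s′} eqv inv → invariant-step inv (rejected? s′) eqv) {input}
      ((λ _ _ → refl) , (λ _ _ → refl) , (λ _ _ → refl) , (λ _ _ → refl) , (λ _ _ → refl) , (λ _ _ → refl))
      (λ _ _ _ → refl) (invariant-start (rejected? input) λ _ _ → mk⇔ (λ r → r) (λ r → r))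

    inv   = proj₁ (proj₂ final)
    fixed = proj₁ (proj₂ (proj₂ final))
    Q?    = proposes? (Invariant.rejected? inv)

module _ {n m} (P : Preferences n m) (U₂ : Subset n) (W₁ : Subset m) (M₁ : PairSet n m)
         (is₁ : IsStable P ⊤ W₁ M₁) where
  open Market P U₂ ⊤ (indicator M₁)
  open Truncation P {U₂ = U₂} {W₂ = ⊤} ⊆⊤ ⊆⊤ (toStable is₁)
  open DeferredAcceptance (dual P) ⊤ U₂ using (Invariant; invariant-start; invariant-step; proposes?)

  private
    c₀ : Stmt
    c₀ = scan women (cell 5) 7 1

    loaded : Loaded input
    loaded = (λ _ _ → refl) , (λ _ _ → refl) , (λ _ _ → refl) , (λ _ _ → refl) , (λ _ _ → refl) , (λ _ _ → refl)

  indicator⁻ : ∀ {u w} → indicator M₁ u w ≢ 0 → ⟨ u , w ⟩∈ M₁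
  indicator⁻ {u} {w} nz with w ∈? lookup M₁ u
  ... | yes e = e
  ... | no _  = contradiction refl nz

  indicator⁺ : ∀ {u w} → ⟨ u , w ⟩∈ M₁ → indicator M₁ u w ≢ 0
  indicator⁺ {u} {w} e with w ∈? lookup M₁ u
  ... | yes _ = λ ()
  ... | no ¬e = contradiction e ¬e

  initially-rejected : ∀ u w → Rejected (exec c₀ input) u w ⇔ Refused w u
  initially-rejected u w with scan-weights {input} loaded u w
  ... | inj₁ ((u∈ , w∈ , w′ , w′∈ , p , g) , one) = mk⇔
    (λ _ → w∈ , u∈ , w′ , indicator⁻ (subst (_≢ 0) (table-inside (indicator M₁) u∈ w′∈) g) , p)
    (λ _ z → contradiction (trans (sym one) z) λ ())
  ... | inj₂ (¬dom , same) = mk⇔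
    (λ r → contradiction same r)
    (λ (w∈ , u∈ , w′ , e , p) → contradiction
      (u∈ , w∈ , w′ , ∈⊤ , p , subst (_≢ 0) (sym (table-inside (indicator M₁) u∈ ∈⊤)) (indicator⁺ e)) ¬dom)

  stage₂-correct : ∀ {k d} → factor stage₂ ≤ k → degree stage₂ ≤ d →
    ∃[ M ] (ComputesWithin (compile stage₂) input (polyBound k d U₂ (⊤ {m})) M ×
            IsMaxWeightStable P U₂ ⊤ (indicator M₁) M)
  stage₂-correct k≤ d≤ = pairSet Q? , displays-computes P U₂ ⊤ (indicator M₁) stage₂ _ _ k≤ d≤ Q? (proj₂ (proj₂ (proj₂ final))) ,
    record
      { isStable = fromStable (truncated-stable inv fixed someStable) (∈-pairSet Q?)
      ; maximal = λ M₂ is₂ → weight-mono {M = M₁} {M₂} {pairSet Q?} λ m₁ m₂ →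
          Equivalence.from (∈-pairSet Q? _ _) (keeps-common inv fixed (toStable is₂) m₁ m₂) }
    where
    final : ∃[ R ] (Invariant Refused (flip R) × Fixed men R × Displays (exec stage₂ input) (Proposes men R))
    final = main-spec men (λ R → Invariant Refused (flip R))
      (λ {s} {s′} eqv inv → invariant-step inv (flip (rejected? s′)) (flip eqv))
      {exec c₀ input} (loaded-exec c₀ {input} _ loaded)
      (λ u w _ → frame c₀ input {6} {toℕ u} {toℕ w} refl)
      (invariant-start (flip (rejected? (exec c₀ input))) (flip initially-rejected))

    inv   = proj₁ (proj₂ final)
    fixed = proj₁ (proj₂ (proj₂ final))

    Q? : ∀ u w → Dec (Proposes men (proj₁ final) u w)
    Q? = flip (proposes? (Invariant.rejected? inv))

    -- That the second market has a stable matching at all follows from the first program, run on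
    -- that market.
    someStable : Stable P U₂ ⊤ _
    someStable = toStable (IsMenOptimal.isStable (proj₂ (proj₂ (stage₁-correct P U₂ ⊤ (indicator M₁) ≤-refl ≤-refl))))

implemented : ∀ {k d} → factor stage₁ ≤ k → factor stage₂ ≤ k → degree stage₁ ≤ d → degree stage₂ ≤ d →
              Implements (compile stage₁) (compile stage₂) k d
implemented k₁≤ k₂≤ d₁≤ d₂≤ P W₁ =
  let M₁ , computed , optimal = stage₁-correct P ⊤ W₁ (λ _ _ → 0) k₁≤ d₁≤
  in M₁ , computed , optimal ,
     λ U₂ → stage₂-correct P U₂ W₁ M₁ (IsMenOptimal.isStable optimal) k₂≤ d₂≤

theorem2 : (∃[ c₁ ] ∃[ c₂ ] ∃[ k ] ∃[ d ] Implements c₁ c₂ k d)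
    ×
    (∀ {n m : ℕ} (P : Preferences n m) (U₂ : Subset n) (W₁ : Subset m)
    (M₁* M₂* : PairSet n m) →
    IsMenOptimal P ⊤ W₁ M₁* →
    IsMaxWeightStable P U₂ ⊤ (indicator M₁*) M₂* →
    IsStable P ⊤ W₁ M₁*
    × IsStable P U₂ ⊤ M₂*
    × (∀ (M₁ M₂ : PairSet n m) → IsStable P ⊤ W₁ M₁ → IsStable P U₂ ⊤ M₂ →
    size (M₁* ∖ M₂*) ≤ size (M₁ ∖ M₂)))
theorem2 =
  (compile stage₁ , compile stage₂ , 
    factor stage₁ + factor stage₂ , degree stage₁ + degree stage₂ ,
    implemented (m≤m+n (factor stage₁) (factor stage₂)) (m≤n+m (factor stage₂) (factor stage₁))
                (m≤m+n (degree stage₁) (degree stage₂)) (m≤n+m (degree stage₂) (degree stage₁))) ,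
  λ P U₂ W₁ M₁* M₂* opt max →
    IsMenOptimal.isStable opt , IsMaxWeightStable.isStable max ,
    online-optimal P U₂ W₁ M₁* M₂* opt max
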